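{- Let $n,k,l,r$ be any integers with $n\geq k+l$ and $l\geq r\geq 1$, let $c$ be a positive constant, and let $\mathscr{A}\subseteq \binom{[n]}{k}$ and $\mathscr{B}\subseteq \binom{[n]}{l}$. If $\mathscr{A}$ and $\mathscr{B}$ are cross-intersecting and $\binom{n-r}{l-r}\leq|\mathscr{B}|\leq \binom{n-1}{l-1}$, then $$|\mathscr{A}|+c|\mathscr{B}|\leq \max\left\{\binom{n}{k}-\binom{n-r}{k}+c\binom{n-r}{l-r},\ \binom{n-1}{k-1}+c\binom{n-1}{l-1}\right\},$$ and the upper bound is attained if and only if one of the following holds: (i) $\binom{n}{k}-\binom{n-r}{k}+c\binom{n-r}{l-r}\geq\binom{n-1}{k-1}+c\binom{n-1}{l-1}$, $n>k+l$, $\mathscr{A}=\{A\in \binom{[n]}{k}:[r]\cap A\neq \emptyset\}$ and $\mathscr{B}=\{B\in\binom{[n]}{l}:[r]\subseteq B\}$; (ii) $\binom{n}{k}-\binom{n-r}{k}+c\binom{n-r}{l-r}\leq\binom{n-1}{k-1}+c\binom{n-1}{l-1}$, $n>k+l$, $\mathscr{A}=\{A\in \binom{[n]}{k}:1\in A\}$ and $\mathscr{B}=\{B\in \binom{[n]}{l}:1\in B\}$; (iii) $n=k+l$, $c<1$, $\mathscr{B}\subset\binom{[n]}{l}$ with $|\mathscr{B}|=\binom{n-r}{l-r}$, and $\mathscr{A}=\binom{[n]}{k}\setminus\overline{\mathscr{B}}$; (iv) $n=k+l$, $c=1$, $\mathscr{B}\subset\binom{[n]}{l}$ with $\binom{n-r}{l-r}\leq|\mathscr{B}|\leq\binom{n-1}{l-1}$,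 and $\mathscr{A}=\binom{[n]}{k}\setminus\overline{\mathscr{B}}$; (v) $n=k+l$, $c>1$, $\mathscr{B}\subset\binom{[n]}{l}$ with $|\mathscr{B}|=\binom{n-1}{l-1}$, and $\mathscr{A}=\binom{[n]}{k}\setminus\overline{\mathscr{B}}$.
   Context: For a natural number $m$, $[m]=\{1,2,\dots,m\}$, and for an integer $i>0$, $\binom{[n]}{i}$ denotes the collection of all $i$-element subsets of $[n]$. Two families $\mathscr{A},\mathscr{B}$ of subsets of $[n]$ are called cross-intersecting if $A\cap B\neq\emptyset$ for all $A\in\mathscr{A}$ and $B\in\mathscr{B}$. For a family $\mathscr{B}$ of subsets of $[n]$, $\overline{\mathscr{B}}=\{[n]\setminus B: B\in\mathscr{B}\}$.
   Formalization: In (i) and (ii) the families are determined only up to one common permutation of [n] (read literally, the "only if" fails, e.g. for the star at 2); c lies in any ordered field with decidable order, which classically includes the reals; k ≥ 1 is explicit. -}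

module Defs where

open import Algebra.Bundles using (CommutativeRing)
import Algebra.Construct.NaturalChoice.Max as Max
import Algebra.Definitions.RawMonoid as RawMonoidDefs
open import Data.Fin.Base using (toℕ)
open import Data.Fin.Permutation using (Permutation′; _⟨$⟩ˡ_)
open import Data.Fin.Subset using (Subset; _∈_; _∩_; ∁; ∣_∣; Nonempty)
open import Data.List.Base using (List; length)
import Data.List.Membership.Propositional as List
open import Data.List.Relation.Unary.Unique.Propositional using (Unique)
open import Data.Nat.Base using (ℕ)
open import Data.Nat.Properties using (_<?_)
open import Data.Product.Base using (∃; _×_)
open import Data.Vec.Base using (tabulate; lookup)
open import Level using (0ℓ; suc; _⊔_)
open import Relation.Binary.Bundles using (DecTotalOrder)
open import Relation.Binary.Core using (Rel)
import Relation.Binary.Construct.NonStrictToStrict as ToStrict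
open import Relation.Binary.PropositionalEquality.Core using (_≡_)
open import Relation.Binary.Structures using (IsDecTotalOrder)
open import Relation.Nullary.Decidable.Core using (does)
open import Relation.Nullary.Negation.Core using (¬_)
open import Relation.Unary using (Pred; _≐_)

-- Real constants are elements of an arbitrary totally ordered field.
-- Decidability of the order is the law of trichotomy, which holds
-- classically in ℝ.
record OrderedField a ℓ₁ ℓ₂ : Set (suc (a ⊔ ℓ₁ ⊔ ℓ₂)) where
  infix 4 _≤_ _<_
  field
    commutativeRing : CommutativeRing a ℓ₁
  open CommutativeRing commutativeRing public
  field
    _≤_             : Rel Carrier ℓ₂
    isDecTotalOrder : IsDecTotalOrder _≈_ _≤_
    0≉1             : ¬ (0# ≈ 1#)
    inverse         : ∀ x → ¬ (x ≈ 0#) → ∃ λ y → x * y ≈ 1#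
    +-monoˡ-≤       : ∀ z {x y} → x ≤ y → x + z ≤ y + z
    *-nonneg        : ∀ {x y} → 0# ≤ x → 0# ≤ y → 0# ≤ x * y

  decTotalOrder : DecTotalOrder a ℓ₁ ℓ₂
  decTotalOrder = record { isDecTotalOrder = isDecTotalOrder }

  _<_ : Rel Carrier (ℓ₁ ⊔ ℓ₂)
  _<_ = ToStrict._<_ _≈_ _≤_

  open Max (DecTotalOrder.totalOrder decTotalOrder) public
    using () renaming (_⊔_ to max)

  -- The canonical map ℕ → Carrier, m ↦ 1 + ⋯ + 1.
  ι : ℕ → Carrier
  ι m = RawMonoidDefs._×_ +-rawMonoid m 1#

-- The ground set [n] = {1,…,n} is Fin n; the index i stands for the
-- element toℕ i + 1.  Families are duplicate-free lists, and are compared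
-- only through membership (⟦_⟧) and cardinality (#_).
record Family (n : ℕ) : Set where
  field
    members : List (Subset n)
    unique  : Unique members

#_ : ∀ {n} → Family n → ℕ
# 𝒜 = length (Family.members 𝒜)

⟦_⟧ : ∀ {n} → Family n → Pred (Subset n) 0ℓ
⟦ 𝒜 ⟧ S = S List.∈ Family.members 𝒜

binom[_] : ∀ n → ℕ → Pred (Subset n) 0ℓ
binom[ n ] i S = ∣ S ∣ ≡ i

CrossIntersecting : ∀ {n} → Family n → Family n → Set
CrossIntersecting 𝒜 ℬ = ∀ {A B} → ⟦ 𝒜 ⟧ A → ⟦ ℬ ⟧ B → Nonempty (A ∩ B)

-- The family {[n] ∖ B : B ∈ ℬ}.
co : ∀ {n} → Family n → Pred (Subset n) 0ℓ
co ℬ S = ∃ λ B → ⟦ ℬ ⟧ B × S ≡ ∁ B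

-- The subset [r] = {1,…,r} of [n], for r ≤ n.
[_] : ∀ {n} → ℕ → Subset n
[ r ] = tabulate λ i → does (toℕ i <? r)

Contains1 : ∀ {n} → Pred (Subset n) 0ℓ
Contains1 S = ∃ λ i → toℕ i ≡ 0 × i ∈ S

-- The image σ(S) = {σ(i) : i ∈ S}.
image : ∀ {n} → Permutation′ n → Subset n → Subset n
image σ S = tabulate λ i → lookup S (σ ⟨$⟩ˡ i)

-- σ(𝒜) = 𝒫 and σ(ℬ) = 𝒬 for a single permutation σ of the ground set.
-- Relabelling [n] preserves uniformity, sizes and cross-intersection, so
-- extremal pairs can only be determined up to this relation.
EqualUpToRelabelling : ∀ {n} → (𝒜 ℬ : Family n) (𝒫 𝒬 : Pred (Subset n) 0ℓ) → Set
EqualUpToRelabelling {n} 𝒜 ℬ 𝒫 𝒬 = ∃ λ (σ : Permutation′ n) →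
  ⟦ 𝒜 ⟧ ≐ (λ S → 𝒫 (image σ S)) × ⟦ ℬ ⟧ ≐ (λ S → 𝒬 (image σ S))

{-# OPTIONS --safe #-}
-- Let b = n − l and let F be the b-uniform family of complements of the
-- members of ℬ.  A k-set meets every B ∈ ℬ iff it is not a subset of a member
-- of F, so |𝒜| plus the size of the k-shadow of F is at most C(n,k).
--
-- The shadow is bounded by a piecewise linear form of the Kruskal–Katona
-- theorem: for t ∈ [0,1] and b ≤ x, |F| ≥ C(x,b) + t C(x,b−1) implies
-- |∂F| ≥ C(x,b−1) + t C(x,b−2).  Induct on b through the links F(v).  Since
-- |∂F| ≥ |F(v)| + |∂F(v)| and the bounds satisfy Pascal's rule, a vertex whose
-- link and link shadow are both large suffices; if there is none, every link
-- has a large ratio |∂F(v)| / |F(v)|, and averaging over v gives the same for F.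
-- For integral x, equality forces the link of a vertex to be extremal, and
-- hence F to consist of all b-subsets of an x-set.
--
-- The points (C(x,b), C(x,k)) with k < b lie on a strictly concave curve, so
-- for n > k + l the pair (|ℬ|, |𝒜|) lies strictly below the chord between the
-- two end configurations unless |ℬ| is an end of its range; a linear function
-- is then maximal only at the ends.  For n = k + l the k-shadow is F itself,
-- and |𝒜| + |ℬ| ≤ C(n,k) decides everything.
module Submission where

open import Defs
open import Data.Fin.Subset using (Nonempty; _∩_) renaming (_⊆_ to _⊆ₛ_)
open import Data.Nat.Base as ℕ using (ℕ; _∸_; zero; suc; z≤n; s≤s)
open import Data.Nat.Combinatorics using (_C_; nCk+nC[k+1]≡[n+1]C[k+1]; nCn≡1; nC1≡n; nCk≡nC[n∸k]; k>n⇒nCk≡0)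
open import Data.Product.Base using (_×_; _,_; ∃; proj₁; proj₂)
open import Data.Sum.Base using (_⊎_; inj₁; inj₂)
open import Function.Bundles using (_⇔_; mk⇔; module Equivalence)
open import Relation.Binary.PropositionalEquality as ≡ using (_≡_; refl; cong; cong₂; subst; subst₂)
open import Relation.Nullary.Negation.Core using (¬_)
open import Relation.Unary using (_⊆_; _≐_)

import Algebra.Construct.NaturalChoice.Max as Max
import Algebra.Properties.Semiring.Mult as Mult
import Algebra.Solver.Ring.NaturalCoefficients.Default as SemiringSolver
open import Data.Empty using (⊥-elim)
import Data.Nat.Properties as ℕ
open import Data.Nat.Tactic.RingSolver using (solve-∀)
open import Function.Base using (_∘_)
open import Relation.Binary.Bundles using (DecTotalOrder)
import Relation.Binary.Reasoning.PartialOrder as PosetReasoning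
open import Relation.Nullary using (yes; no)

open Equivalence using (to; from)

-- The interpolation is needed because |ℬ| may lie anywhere between two binomial coefficients. For r
-- = 2 the ends of its range are consecutive values C(x,b), so the chord is itself one linear piece
-- and concavity yields no strict inequality there. Strictness therefore has two sources. For 0 < t
-- < 1 the shadow bound itself is strict, by an integrality argument on 1-uniform links; for t = 0
-- inside the range, the slopes of successive pieces strictly decrease.
--
-- The parameter t is a fraction p / q, and every inequality is multiplied through by q, so that all
-- counting stays in ℕ. With q = C(x,b-1), each size from C(x,b) up to C(x+1,b) is C(x,b) + t
-- C(x,b-1) exactly, and binomial coefficients of real argument never arise.
--
-- The induction meets links of uncontrolled size. Its statement therefore has no lower bound on |F|
-- as a hypothesis, but an alternative: a large shadow or a large ratio |∂F| / |F|.

module Combinatorics where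
  open import Algebra.Properties.CommutativeMonoid.Sum ℕ.+-0-commutativeMonoid using (sum-permute)
  open import Algebra.Properties.Semiring.Sum ℕ.+-*-semiring using (sum; sum-cong-≗; *-distribʳ-sum)
  open import Data.Bool.Base using (Bool; true; false; T; not; _∧_)
  open import Data.Bool.Properties using (T-≡; T-not-≡; T-∧; T?; not-involutive) renaming (_≟_ to _≟ᵇ_)
  open import Data.Fin.Base using (Fin; zero; suc; toℕ; fromℕ<; punchIn)
  open import Data.Fin.Permutation as Perm using (Permutation′; _⟨$⟩ˡ_; _⟨$⟩ʳ_; lift₀; insert; insert-punchIn)
  import Data.Fin.Properties as Fin
  open import Data.Fin.Properties using (any?)
  open import Data.Fin.Subset using (Subset; inside; outside; _∈_; ∁; ∣_∣) renaming (⊥ to ∅)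
  open import Data.Fin.Subset.Properties using (∣p∣≤n; ∣∁p∣≡n∸∣p∣; x∈p∩q⁺; x∈p∩q⁻; ∣⊥∣≡0)
  open import Data.List.Base using (List; []; _∷_; length)
  import Data.List.Membership.DecPropositional as DecMembership
  import Data.List.Membership.Propositional as List
  open import Data.List.Relation.Unary.All.Properties using (All¬⇒¬Any)
  open import Data.List.Relation.Unary.AllPairs using ([]; _∷_)
  open import Data.List.Relation.Unary.Any using (here; there)
  open import Data.List.Relation.Unary.Unique.Propositional using (Unique)
  open import Data.Nat.Base using (_+_; _*_; _≤_; _<_; _<ᵇ_; _≡ᵇ_; s≤s⁻¹; >-nonZero)
  open import Data.Nat.Properties
  open import Data.Unit.Base using (tt)
  open import Data.Vec.Base using ([]; _∷_; head; tail; lookup; _[_]≔_; tabulate)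
  open import Data.Vec.Properties
    using (≡-dec; lookup∘update; lookup∘update′; []≔-idempotent; []≔-commutes; []≔-lookup;
           []=⇒lookup; lookup⇒[]=; lookup∘tabulate; lookup-map; lookup-replicate)
  open import Relation.Binary.PropositionalEquality using (_≢_; sym; trans; module ≡-Reasoning)
  open import Relation.Nullary.Decidable using (⌊_⌋; toWitness; fromWitness; _×-dec_)

  private variable n : ℕ

  -- Binomial coefficients: Pascal's rule, absorption, monotonicity.

  pascal : ∀ n k → (suc n C suc k) ≡ (n C k) + (n C suc k)
  pascal n k = sym (nCk+nC[k+1]≡[n+1]C[k+1] n k)

  nC0≡1 : ∀ n → (n C 0) ≡ 1
  nC0≡1 n = trans (nCk≡nC[n∸k] {0} {n} z≤n) (nCn≡1 n)

  -- This is (k+1) C(n,k+1) = (n-k) C(n,k) with the subtraction moved to the other side, so that it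
  -- holds for all n and k, also beyond k = n.
  absorption : ∀ n k → suc k * (n C suc k) + k * (n C k) ≡ n * (n C k)
  absorption zero zero = refl
  absorption zero (suc k) = begin
    suc (suc k) * (0 C suc (suc k)) + suc k * (0 C suc k)
      ≡⟨ cong₂ (λ a b → suc (suc k) * a + suc k * b)
               (k>n⇒nCk≡0 {0} {suc (suc k)} (s≤s z≤n)) (k>n⇒nCk≡0 {0} {suc k} (s≤s z≤n)) ⟩
    suc (suc k) * 0 + suc k * 0
      ≡⟨ cong₂ _+_ (*-zeroʳ (suc (suc k))) (*-zeroʳ (suc k)) ⟩
    0 ∎ where open ≡-Reasoning
  absorption (suc n) zero = begin
    1 * (suc n C 1) + 0   ≡⟨ cong (λ a → 1 * a + 0) (pascal n 0) ⟩
    1 * ((n C 0) + (n C 1)) + 0 ≡⟨ solve-∀′ (n C 0) (n C 1) ⟩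
    (1 * (n C 1) + 0 * (n C 0)) + (n C 0) ≡⟨ cong (_+ (n C 0)) (absorption n 0) ⟩
    n * (n C 0) + (n C 0)  ≡⟨ cong₂ (λ a b → n * a + b) (nC0≡1 n) (nC0≡1 n) ⟩
    n * 1 + 1  ≡⟨ cong (_+ 1) (*-identityʳ n) ⟩
    n + 1 ≡⟨ +-comm n 1 ⟩
    suc n ≡⟨ *-identityʳ (suc n) ⟨
    suc n * 1 ≡⟨ cong (suc n *_) (nC0≡1 (suc n)) ⟨
    suc n * (suc n C 0) ∎
    where
    open ≡-Reasoning
    solve-∀′ : ∀ a b → 1 * (a + b) + 0 ≡ (1 * b + 0 * a) + a
    solve-∀′ = solve-∀
  absorption (suc n) (suc k) = begin
    suc (suc k) * (suc n C suc (suc k)) + suc k * (suc n C suc k)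
      ≡⟨ cong₂ (λ a b → suc (suc k) * a + suc k * b) (pascal n (suc k)) (pascal n k) ⟩
    suc (suc k) * ((n C suc k) + (n C suc (suc k))) + suc k * ((n C k) + (n C suc k))
      ≡⟨ regroup k (n C k) (n C suc k) (n C suc (suc k)) ⟩
    (suc (suc k) * (n C suc (suc k)) + suc k * (n C suc k)) + (suc k * (n C suc k) + k * (n C k)) + ((n C k) + (n C suc k))
      ≡⟨ cong₂ (λ a b → a + b + ((n C k) + (n C suc k))) (absorption n (suc k)) (absorption n k) ⟩
    n * (n C suc k) + n * (n C k) + ((n C k) + (n C suc k))
      ≡⟨ collect n (n C k) (n C suc k) ⟩
    suc n * ((n C k) + (n C suc k))
      ≡⟨ cong (suc n *_) (pascal n k) ⟨
    suc n * (suc n C suc k) ∎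
    where
    open ≡-Reasoning
    regroup : ∀ k a b c → suc (suc k) * (b + c) + suc k * (a + b) ≡ (suc (suc k) * c + suc k * b) + (suc k * b + k * a) + (a + b)
    regroup = solve-∀
    collect : ∀ n a b → n * b + n * a + (a + b) ≡ suc n * (a + b)
    collect = solve-∀

  absorption-+ : ∀ k z → suc k * ((k + z) C suc k) ≡ z * ((k + z) C k)
  absorption-+ k z = +-cancelʳ-≡ (k * ((k + z) C k)) _ _ (begin
    suc k * ((k + z) C suc k) + k * ((k + z) C k) ≡⟨ absorption (k + z) k ⟩
    (k + z) * ((k + z) C k)                     ≡⟨ *-distribʳ-+ ((k + z) C k) k z ⟩
    k * ((k + z) C k) + z * ((k + z) C k)         ≡⟨ +-comm (k * ((k + z) C k)) _ ⟩
    z * ((k + z) C k) + k * ((k + z) C k)         ∎)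
    where open ≡-Reasoning

  C-pos : ∀ {n k} → k ≤ n → 0 < (n C k)
  C-pos {n} {zero} _ = subst (0 <_) (sym (nC0≡1 n)) (s≤s z≤n)
  C-pos {suc n} {suc k} (s≤s k≤n) =
    subst (0 <_) (sym (pascal n k)) (≤-trans (C-pos k≤n) (m≤m+n _ _))

  C-mono-≤ : ∀ {m n} k → m ≤ n → (m C k) ≤ (n C k)
  C-mono-≤ {m} {n} zero _ = ≤-reflexive (trans (nC0≡1 m) (sym (nC0≡1 n)))
  C-mono-≤ {zero} {n} (suc k) z≤n = subst (_≤ (n C suc k)) (sym (k>n⇒nCk≡0 {0} {suc k} (s≤s z≤n))) z≤n
  C-mono-≤ {suc m} {suc n} (suc k) (s≤s m≤n) =
    subst₂ _≤_ (sym (pascal m k)) (sym (pascal n k)) (+-mono-≤ (C-mono-≤ k m≤n) (C-mono-≤ (suc k) m≤n))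

  C-mono-< : ∀ {m n} k → k ≤ m → m < n → (m C suc k) < (n C suc k)
  C-mono-< {m} k k≤m m<n = ≤-trans
    (subst (m C suc k <_) (sym (pascal m k)) (+-monoˡ-≤ (m C suc k) (C-pos k≤m)))
    (C-mono-≤ (suc k) m<n)

  -- Interpolated binomial coefficients.

  -- With t = p / q, the number q · (C(x,b) + t · C(x,b−1)): q times the
  -- linear interpolation of x ↦ C(x,b) at x + t.
  φ : (p q x b : ℕ) → ℕ
  φ p q x zero    = q * (x C 0)
  φ p q x (suc b) = q * (x C suc b) + p * (x C b)

  -- Pascal's rule is linear, so it passes to a combination with fixed coefficients. The clause of
  -- `φ` at b = 0 reads C(x,-1) as 0, which makes the rule hold from the bottom.
  φ-pascal : ∀ p q x b → φ p q (suc x) (suc b) ≡ φ p q x (suc b) + φ p q x b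
  φ-pascal p q x zero = begin
    q * (suc x C 1) + p * (suc x C 0)
      ≡⟨ cong₂ (λ a b → q * a + p * b) (pascal x 0) (trans (nC0≡1 (suc x)) (sym (nC0≡1 x))) ⟩
    q * ((x C 0) + (x C 1)) + p * (x C 0) ≡⟨ regroup p q (x C 0) (x C 1) ⟩
    q * (x C 1) + p * (x C 0) + q * (x C 0) ∎
    where
    open ≡-Reasoning
    regroup : ∀ p q a b → q * (a + b) + p * a ≡ q * b + p * a + q * a
    regroup = solve-∀
  φ-pascal p q x (suc b) = begin
    q * (suc x C suc (suc b)) + p * (suc x C suc b)
      ≡⟨ cong₂ (λ u v → q * u + p * v) (pascal x (suc b)) (pascal x b) ⟩
    q * ((x C suc b) + (x C suc (suc b))) + p * ((x C b) + (x C suc b))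
      ≡⟨ regroup p q (x C b) (x C suc b) (x C suc (suc b)) ⟩
    (q * (x C suc (suc b)) + p * (x C suc b)) + (q * (x C suc b) + p * (x C b)) ∎
    where
    open ≡-Reasoning
    regroup : ∀ p q a b c → q * (b + c) + p * (a + b) ≡ (q * c + p * b) + (q * b + p * a)
    regroup = solve-∀

  -- Together with `φ-factor-upper`, this expresses the values of `φ` at b + 1 and at b through the
  -- same binomial coefficient C(b+z,b). It then cancels from ratios of `φ`, leaving polynomials in
  -- p, q, b and z.
  φ-factor-lower : ∀ p q b z → suc b * φ p q (b + z) (suc b) ≡ ((b + z) C b) * (q * z + p * suc b)
  φ-factor-lower p q b z = begin
    suc b * (q * ((b + z) C suc b) + p * ((b + z) C b))
      ≡⟨ regroup p q b ((b + z) C suc b) ((b + z) C b) ⟩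
    q * (suc b * ((b + z) C suc b)) + ((b + z) C b) * (p * suc b)
      ≡⟨ cong (λ u → q * u + ((b + z) C b) * (p * suc b)) (absorption-+ b z) ⟩
    q * (z * ((b + z) C b)) + ((b + z) C b) * (p * suc b)
      ≡⟨ collect p q b z ((b + z) C b) ⟩
    ((b + z) C b) * (q * z + p * suc b) ∎
    where
    open ≡-Reasoning
    regroup : ∀ p q b u v → suc b * (q * u + p * v) ≡ q * (suc b * u) + v * (p * suc b)
    regroup = solve-∀
    collect : ∀ p q b z v → q * (z * v) + v * (p * suc b) ≡ v * (q * z + p * suc b)
    collect = solve-∀

  φ-factor-upper : ∀ p q b z → suc z * φ p q (b + z) b ≡ ((b + z) C b) * (q * suc z + p * b)
  φ-factor-upper p q zero z = regroup p q z (z C 0)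
    where
    regroup : ∀ p q z u → suc z * (q * u) ≡ u * (q * suc z + p * 0)
    regroup = solve-∀
  φ-factor-upper p q (suc b) z = begin
    suc z * (q * ((suc b + z) C suc b) + p * ((suc b + z) C b))
      ≡⟨ regroup p q z ((suc b + z) C suc b) ((suc b + z) C b) ⟩
    ((suc b + z) C suc b) * (q * suc z) + p * (suc z * ((suc b + z) C b))
      ≡⟨ cong (λ u → ((suc b + z) C suc b) * (q * suc z) + p * u) absorb ⟩
    ((suc b + z) C suc b) * (q * suc z) + p * (suc b * ((suc b + z) C suc b))
      ≡⟨ collect p q b z ((suc b + z) C suc b) ⟩
    ((suc b + z) C suc b) * (q * suc z + p * suc b) ∎
    where
    open ≡-Reasoning
    absorb : suc z * ((suc b + z) C b) ≡ suc b * ((suc b + z) C suc b)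
    absorb = subst (λ x → suc z * (x C b) ≡ suc b * (x C suc b)) (+-suc b z) (sym (absorption-+ b (suc z)))
    regroup : ∀ p q z u v → suc z * (q * u + p * v) ≡ u * (q * suc z) + p * (suc z * v)
    regroup = solve-∀
    collect : ∀ p q b z u → u * (q * suc z) + p * (suc b * u) ≡ u * (q * suc z + p * suc b)
    collect = solve-∀

  φ-pos : ∀ {p q x b} → 0 < q → b ≤ x → 0 < φ p q x b
  φ-pos {b = zero}  0<q b≤x = *-mono-≤ 0<q (C-pos b≤x)
  φ-pos {b = suc b} 0<q b≤x = ≤-trans (*-mono-≤ 0<q (C-pos b≤x)) (m≤m+n _ _)

  -- Multiplied by (b + 1)(z + 2), both sides acquire a common factor, and
  -- what remains differs by p (q − p).
  φ-ratio : ∀ {p q} → p ≤ q → ∀ b z → let x = b + z in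
    suc b * φ p q (suc (suc x)) (suc b) * φ p q (suc x) (suc b) ≤
    suc (suc b) * φ p q (suc (suc x)) (suc (suc b)) * φ p q (suc x) b
  φ-ratio {p} {q} p≤q b z with m≤n⇒∃[o]m+o≡n p≤q
  ... | d , refl = *-cancelˡ-≤ (suc b * suc (suc z)) (begin
    (suc b * suc (suc z)) * (suc b * φ p q X (suc b) * φ p q Y (suc b))
      ≡⟨ shuffle₁ (suc b) (2 + z) (φ p q X (suc b)) (φ p q Y (suc b)) ⟩
    (2 + z) * (suc b * φ p q X (suc b)) * (suc b * φ p q Y (suc b))
      ≡⟨ cong₂ (λ u v → (2 + z) * u * v) fX₁ fY₁ ⟩
    (2 + z) * ((X C b) * (q * (2 + z) + p * suc b)) * ((Y C b) * (q * (1 + z) + p * suc b))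
      ≤⟨ ≤-trans (m≤m+n _ ((2 + z) * (X C b) * (Y C b) * (p * d))) (≤-reflexive (key p d b z (X C b) (Y C b))) ⟩
    (2 + z) * (X C b) * (q * (1 + z) + p * suc (suc b)) * ((Y C b) * (q * (2 + z) + p * b))
      ≡⟨ cong (λ u → u * (q * (1 + z) + p * suc (suc b)) * ((Y C b) * (q * (2 + z) + p * b))) absorb ⟨
    suc b * (X C suc b) * (q * (1 + z) + p * suc (suc b)) * ((Y C b) * (q * (2 + z) + p * b))
      ≡⟨ cong (_* ((Y C b) * (q * (2 + z) + p * b))) (*-assoc (suc b) (X C suc b) _) ⟩
    suc b * ((X C suc b) * (q * (1 + z) + p * suc (suc b))) * ((Y C b) * (q * (2 + z) + p * b))
      ≡⟨ cong₂ (λ u v → suc b * u * v) fX₂ fY₂ ⟨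
    suc b * (suc (suc b) * φ p q X (suc (suc b))) * ((2 + z) * φ p q Y b)
      ≡⟨ shuffle₂ (suc b) (suc (suc b)) (2 + z) (φ p q X (suc (suc b))) (φ p q Y b) ⟩
    (suc b * suc (suc z)) * (suc (suc b) * φ p q X (suc (suc b)) * φ p q Y b) ∎)
    where
    open ≤-Reasoning
    X Y : ℕ
    X = suc (suc (b + z))
    Y = suc (b + z)
    eqX₁ : b + (2 + z) ≡ X
    eqX₁ = go b z where
      go : ∀ b z → b + (2 + z) ≡ suc (suc (b + z))
      go = solve-∀
    eqX₂ : suc b + (1 + z) ≡ X
    eqX₂ = go b z where
      go : ∀ b z → suc b + (1 + z) ≡ suc (suc (b + z))
      go = solve-∀
    eqY : b + (1 + z) ≡ Y
    eqY = go b z where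
      go : ∀ b z → b + (1 + z) ≡ suc (b + z)
      go = solve-∀
    fX₁ : suc b * φ p q X (suc b) ≡ (X C b) * (q * (2 + z) + p * suc b)
    fX₁ = subst (λ x → suc b * φ p q x (suc b) ≡ (x C b) * (q * (2 + z) + p * suc b)) eqX₁ (φ-factor-lower p q b (2 + z))
    fY₁ : suc b * φ p q Y (suc b) ≡ (Y C b) * (q * (1 + z) + p * suc b)
    fY₁ = subst (λ x → suc b * φ p q x (suc b) ≡ (x C b) * (q * (1 + z) + p * suc b)) eqY (φ-factor-lower p q b (1 + z))
    fX₂ : suc (suc b) * φ p q X (suc (suc b)) ≡ (X C suc b) * (q * (1 + z) + p * suc (suc b))
    fX₂ = subst (λ x → suc (suc b) * φ p q x (suc (suc b)) ≡ (x C suc b) * (q * (1 + z) + p * suc (suc b))) eqX₂ (φ-factor-lower p q (suc b) (1 + z))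
    fY₂ : (2 + z) * φ p q Y b ≡ (Y C b) * (q * (2 + z) + p * b)
    fY₂ = subst (λ x → (2 + z) * φ p q x b ≡ (x C b) * (q * (2 + z) + p * b)) eqY (φ-factor-upper p q b (1 + z))
    absorb : suc b * (X C suc b) ≡ (2 + z) * (X C b)
    absorb = subst (λ x → suc b * (x C suc b) ≡ (2 + z) * (x C b)) eqX₁ (absorption-+ b (2 + z))
    shuffle₁ : ∀ a c u v → (a * c) * (a * u * v) ≡ c * (a * u) * (a * v)
    shuffle₁ = solve-∀
    shuffle₂ : ∀ a a′ c u v → a * (a′ * u) * (c * v) ≡ (a * c) * (a′ * u * v)
    shuffle₂ = solve-∀
    key : ∀ p d b z u v →
      (2 + z) * (u * ((p + d) * (2 + z) + p * suc b)) * (v * ((p + d) * (1 + z) + p * suc b))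
        + (2 + z) * u * v * (p * d)
      ≡ (2 + z) * u * ((p + d) * (1 + z) + p * suc (suc b)) * (v * ((p + d) * (2 + z) + p * b))
    key = solve-∀

  -- Sums over all subsets, and sizes of families.

  ∑ : (Subset n → ℕ) → ℕ
  ∑ {zero}  g = g []
  ∑ {suc n} g = ∑ (g ∘ (inside ∷_)) + ∑ (g ∘ (outside ∷_))

  ∑-cong : {g h : Subset n → ℕ} → (∀ S → g S ≡ h S) → ∑ g ≡ ∑ h
  ∑-cong {zero}  e = e []
  ∑-cong {suc n} e = cong₂ _+_ (∑-cong (e ∘ (inside ∷_))) (∑-cong (e ∘ (outside ∷_)))

  ∑-mono : {g h : Subset n → ℕ} → (∀ S → g S ≤ h S) → ∑ g ≤ ∑ h
  ∑-mono {zero}  e = e []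
  ∑-mono {suc n} e = +-mono-≤ (∑-mono (e ∘ (inside ∷_))) (∑-mono (e ∘ (outside ∷_)))

  +-interchange : ∀ a b c d → (a + b) + (c + d) ≡ (a + c) + (b + d)
  +-interchange = solve-∀

  ∑-+ : (g h : Subset n → ℕ) → ∑ (λ S → g S + h S) ≡ ∑ g + ∑ h
  ∑-+ {zero}  g h = refl
  ∑-+ {suc n} g h = trans
    (cong₂ _+_ (∑-+ (g ∘ (inside ∷_)) (h ∘ (inside ∷_))) (∑-+ (g ∘ (outside ∷_)) (h ∘ (outside ∷_))))
    (+-interchange (∑ (g ∘ (inside ∷_))) _ _ _)

  ∑-*ˡ : ∀ c (g : Subset n → ℕ) → ∑ (λ S → c * g S) ≡ c * ∑ g
  ∑-*ˡ {zero}  c g = refl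
  ∑-*ˡ {suc n} c g = trans (cong₂ _+_ (∑-*ˡ c (g ∘ (inside ∷_))) (∑-*ˡ c (g ∘ (outside ∷_))))
    (sym (*-distribˡ-+ c (∑ (g ∘ (inside ∷_))) _))

  ∑-zero : (n : ℕ) → ∑ {n} (λ _ → 0) ≡ 0
  ∑-zero zero = refl
  ∑-zero (suc n) = cong₂ _+_ (∑-zero n) (∑-zero n)

  ∑-sum-comm : ∀ {m} (g : Subset n → Fin m → ℕ) → ∑ (λ S → sum (g S)) ≡ sum (λ v → ∑ (λ S → g S v))
  ∑-sum-comm {n = n} {m = zero}  g = ∑-zero n
  ∑-sum-comm {m = suc m} g = trans (∑-+ (λ S → g S zero) (λ S → sum (g S ∘ suc)))
    (cong (∑ (λ S → g S zero) +_) (∑-sum-comm (λ S → g S ∘ suc)))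

  ∑-∁ : (g : Subset n → ℕ) → ∑ (g ∘ ∁) ≡ ∑ g
  ∑-∁ {zero}  g = refl
  ∑-∁ {suc n} g = trans (cong₂ _+_ (∑-∁ (g ∘ (outside ∷_))) (∑-∁ (g ∘ (inside ∷_)))) (+-comm (∑ (g ∘ (outside ∷_))) _)

  sum-mono : {g h : Fin n → ℕ} → (∀ v → g v ≤ h v) → sum g ≤ sum h
  sum-mono {zero}  e = z≤n
  sum-mono {suc m} e = +-mono-≤ (e zero) (sum-mono (e ∘ suc))

  sum-mono-< : {g h : Fin n → ℕ} → (∀ v → g v ≤ h v) → ∀ u → g u < h u → sum g < sum h
  sum-mono-< e zero    s = +-mono-≤ s (sum-mono (e ∘ suc))
  sum-mono-< {h = h} e (suc u) s = subst (_≤ sum h) (+-suc _ _) (+-mono-≤ (e zero) (sum-mono-< (e ∘ suc) u s))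

  -- Boolean predicates make links, shadows and complements pointwise operations, and turn sizes
  -- into sums that split at the first coordinate.
  SetFamily : ℕ → Set
  SetFamily n = Subset n → Bool

  𝟙 : Bool → ℕ
  𝟙 true  = 1
  𝟙 false = 0

  card : SetFamily n → ℕ
  card F = ∑ (𝟙 ∘ F)

  𝟙-mono : ∀ {x y} → (T x → T y) → 𝟙 x ≤ 𝟙 y
  𝟙-mono {false}        _ = z≤n
  𝟙-mono {true} {true}  _ = s≤s z≤n
  𝟙-mono {true} {false} f = ⊥-elim (f tt)

  infix 4 _⊑_
  _⊑_ : SetFamily n → SetFamily n → Set
  F ⊑ G = ∀ {S} → T (F S) → T (G S)

  card-mono : {F G : SetFamily n} → F ⊑ G → card F ≤ card G
  card-mono s = ∑-mono λ S → 𝟙-mono (s {S})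

  card-cong : {F G : SetFamily n} → F ⊑ G → G ⊑ F → card F ≡ card G
  card-cong {F = F} {G} s t = ≤-antisym (card-mono {F = F} {G} s) (card-mono {F = G} {F} t)

  -- Neither half of F, at the first coordinate, exceeds the same half of G, so equality of the
  -- totals forces it in both halves. Every uniqueness claim below turns a count into an equality of
  -- families through this.
  card-⊑-≡ : {F G : SetFamily n} → F ⊑ G → card G ≤ card F → G ⊑ F
  card-⊑-≡ {zero} {F} {G} s le {[]} t with F [] | G [] | le
  ... | true  | _    | _ = tt
  ... | false | true | ()
  card-⊑-≡ {suc n} {F} {G} s le {x ∷ S} = go x
    where
    Fi = F ∘ (inside ∷_)
    Fo = F ∘ (outside ∷_)
    Gi = G ∘ (inside ∷_)
    Go = G ∘ (outside ∷_)
    go : ∀ x → T (G (x ∷ S)) → T (F (x ∷ S))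
    go true  = card-⊑-≡ {F = Fi} {Gi} s (+-cancelʳ-≤ (card Go) _ _
      (≤-trans le (+-monoʳ-≤ (card Fi) (card-mono {F = Fo} {Go} s))))
    go false = card-⊑-≡ {F = Fo} {Go} s (+-cancelˡ-≤ (card Gi) _ _
      (≤-trans le (+-monoˡ-≤ (card Fo) (card-mono {F = Fi} {Gi} s))))

  card-disjoint : (F G H : SetFamily n) → F ⊑ H → G ⊑ H → (∀ {S} → T (F S) → ¬ T (G S)) → card F + card G ≤ card H
  card-disjoint F G H f g d = subst (_≤ card H) (∑-+ (𝟙 ∘ F) (𝟙 ∘ G)) (∑-mono λ S → go (F S) (G S) (H S) f g d)
    where
    go : ∀ x y z → (T x → T z) → (T y → T z) → (T x → ¬ T y) → 𝟙 x + 𝟙 y ≤ 𝟙 z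
    go false y z f g d = 𝟙-mono g
    go true false z f g d = 𝟙-mono f
    go true true z f g d = ⊥-elim (d tt tt)

  card-cover : (F G H : SetFamily n) → (∀ {S} → T (H S) → T (F S) ⊎ T (G S)) → card H ≤ card F + card G
  card-cover F G H c = subst (card H ≤_) (∑-+ (𝟙 ∘ F) (𝟙 ∘ G)) (∑-mono λ S → go (F S) (G S) (H S) c)
    where
    go : ∀ x y z → (T z → T x ⊎ T y) → 𝟙 z ≤ 𝟙 x + 𝟙 y
    go x y false c = z≤n
    go true y true c = s≤s z≤n
    go false true true c = s≤s z≤n
    go false false true c with c tt
    ... | inj₁ ()
    ... | inj₂ ()

  card-pos : (F : SetFamily n) {S : Subset n} → T (F S) → 0 < card F
  card-pos {zero} F {[]} t with F []
  ... | true = s≤s z≤n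
  card-pos {suc n} F {true  ∷ S} t = ≤-trans (card-pos (F ∘ (inside ∷_)) t) (m≤m+n _ _)
  card-pos {suc n} F {false ∷ S} t = ≤-trans (card-pos (F ∘ (outside ∷_)) t) (m≤n+m _ _)

  card-inhabited : (F : SetFamily n) → 0 < card F → ∃ λ S → T (F S)
  card-inhabited {zero} F p with F [] in eq
  ... | true = [] , subst T (sym eq) tt
  card-inhabited {suc n} F p with card (F ∘ (inside ∷_)) in eq
  ... | suc _ = let (S , t) = card-inhabited (F ∘ (inside ∷_)) (subst (0 <_) (sym eq) (s≤s z≤n)) in inside ∷ S , t
  ... | zero  = let (S , t) = card-inhabited (F ∘ (outside ∷_)) p in outside ∷ S , t

  -- S ↦ S ∪ {v} maps the sets avoiding v bijectively onto those containing v.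
  ∑-insert : (v : Fin n) (g : Subset n → ℕ) →
    ∑ (λ S → 𝟙 (not (lookup S v)) * g (S [ v ]≔ inside)) ≡ ∑ (λ S → 𝟙 (lookup S v) * g S)
  ∑-insert {suc n} zero g = trans (cong (_+ ∑ (λ S → 1 * g (inside ∷ S))) (∑-zero n))
    (sym (trans (cong (∑ (λ S → 1 * g (inside ∷ S)) +_) (∑-zero n)) (+-identityʳ _)))
  ∑-insert {suc n} (suc v) g = cong₂ _+_ (∑-insert v (g ∘ (inside ∷_))) (∑-insert v (g ∘ (outside ∷_)))

  sum-lookup : (S : Subset n) → sum (λ v → 𝟙 (lookup S v)) ≡ ∣ S ∣
  sum-lookup [] = refl
  sum-lookup (true ∷ S) = cong suc (sum-lookup S)
  sum-lookup (false ∷ S) = sum-lookup S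

  -- Links, shadows and double counting.

  link : SetFamily n → Fin n → SetFamily n
  link F v S = not (lookup S v) ∧ F (S [ v ]≔ inside)

  avoid : SetFamily n → Fin n → SetFamily n
  avoid F v S = not (lookup S v) ∧ F S

  shadow : SetFamily n → SetFamily n
  shadow F S = ⌊ any? (λ v → T? (link F v S)) ⌋

  Uniform : SetFamily n → ℕ → Set
  Uniform F b = ∀ {S} → T (F S) → ∣ S ∣ ≡ b

  ¬T⇒T-not : ∀ {x} → ¬ T x → T (not x)
  ¬T⇒T-not {false} _ = tt
  ¬T⇒T-not {true}  f = f tt

  true≢false : ∀ {x} → x ≡ true → x ≡ false → ∀ {a} {A : Set a} → A
  true≢false refl ()

  link⁻ : (F : SetFamily n) {v : Fin n} {S : Subset n} → T (link F v S) → lookup S v ≡ false × T (F (S [ v ]≔ inside))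
  link⁻ F t = let (a , b) = to T-∧ t in to T-not-≡ a , b

  link⁺ : (F : SetFamily n) {v : Fin n} {S : Subset n} → lookup S v ≡ false → T (F (S [ v ]≔ inside)) → T (link F v S)
  link⁺ F a b = from T-∧ (from T-not-≡ a , b)

  shadow⁻ : (F : SetFamily n) {S : Subset n} → T (shadow F S) → ∃ λ v → T (link F v S)
  shadow⁻ F t = toWitness t

  shadow⁺ : (F : SetFamily n) {S : Subset n} (v : Fin n) → T (link F v S) → T (shadow F S)
  shadow⁺ F v t = fromWitness (v , t)

  reinsert : (S : Subset n) (v : Fin n) → lookup S v ≡ true → (S [ v ]≔ outside) [ v ]≔ inside ≡ S
  reinsert S v e = trans ([]≔-idempotent S v) (trans (cong (S [ v ]≔_) (sym e)) ([]≔-lookup S v))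

  link-delete : (F : SetFamily n) (v : Fin n) {S : Subset n} → T (F S) → lookup S v ≡ true → T (link F v (S [ v ]≔ outside))
  link-delete F v {S} t e = link⁺ F (lookup∘update v S outside) (subst (T ∘ F) (sym (reinsert S v e)) t)

  ∣insert∣ : (S : Subset n) (v : Fin n) → lookup S v ≡ false → ∣ S [ v ]≔ inside ∣ ≡ suc ∣ S ∣
  ∣insert∣ (false ∷ S) zero    e = refl
  ∣insert∣ (true  ∷ S) (suc v) e = cong suc (∣insert∣ S v e)
  ∣insert∣ (false ∷ S) (suc v) e = ∣insert∣ S v e

  ∣insert∣≤ : (S : Subset n) (v : Fin n) → ∣ S [ v ]≔ inside ∣ ≤ suc ∣ S ∣
  ∣insert∣≤ S v with lookup S v in eq
  ... | false = ≤-reflexive (∣insert∣ S v eq)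
  ... | true  = ≤-trans (≤-reflexive (cong ∣_∣ (trans (cong (S [ v ]≔_) (sym eq)) ([]≔-lookup S v)))) (n≤1+n _)

  uniform-link : {F : SetFamily n} {b : ℕ} → Uniform F (suc b) → ∀ v → Uniform (link F v) b
  uniform-link {F = F} u v {S} t = let (e , f) = link⁻ F t in suc-injective (trans (sym (∣insert∣ S v e)) (u f))

  uniform-shadow : {F : SetFamily n} {b : ℕ} → Uniform F (suc b) → Uniform (shadow F) b
  uniform-shadow {F = F} u t = let (v , t′) = shadow⁻ F t in uniform-link {F = F} u v t′

  element : (S : Subset n) {k : ℕ} → ∣ S ∣ ≡ suc k → ∃ λ v → lookup S v ≡ true
  element (true ∷ S) e = zero , refl
  element (false ∷ S) e = let (v , p) = element S e in suc v , p

  card-link : (F : SetFamily n) (v : Fin n) → card (link F v) ≡ ∑ (λ S → 𝟙 (lookup S v) * 𝟙 (F S))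
  card-link F v = trans (∑-cong λ S → 𝟙-∧ (not (lookup S v)) (F (S [ v ]≔ inside))) (∑-insert v (𝟙 ∘ F))
    where
    𝟙-∧ : ∀ x y → 𝟙 (x ∧ y) ≡ 𝟙 x * 𝟙 y
    𝟙-∧ false y = refl
    𝟙-∧ true  y = sym (*-identityˡ (𝟙 y))

  -- Double counting of the pairs v ∈ S ∈ F.
  degree-sum : (F : SetFamily n) {b : ℕ} → Uniform F b → sum (λ v → card (link F v)) ≡ b * card F
  degree-sum F {b} u = begin
    sum (λ v → card (link F v))                       ≡⟨ sum-cong-≗ (card-link F) ⟩
    sum (λ v → ∑ (λ S → 𝟙 (lookup S v) * 𝟙 (F S)))    ≡⟨ ∑-sum-comm (λ S v → 𝟙 (lookup S v) * 𝟙 (F S)) ⟨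
    ∑ (λ S → sum (λ v → 𝟙 (lookup S v) * 𝟙 (F S)))
      ≡⟨ ∑-cong (λ S → *-distribʳ-sum (𝟙 (F S)) (λ v → 𝟙 (lookup S v))) ⟨
    ∑ (λ S → sum (λ v → 𝟙 (lookup S v)) * 𝟙 (F S))    ≡⟨ ∑-cong (λ S → cong (_* 𝟙 (F S)) (sum-lookup S)) ⟩
    ∑ (λ S → ∣ S ∣ * 𝟙 (F S))                          ≡⟨ ∑-cong size ⟩
    ∑ (λ S → b * 𝟙 (F S))                              ≡⟨ ∑-*ˡ b (𝟙 ∘ F) ⟩
    b * card F ∎
    where
    open ≡-Reasoning
    size : ∀ S → ∣ S ∣ * 𝟙 (F S) ≡ b * 𝟙 (F S)
    size S with F S in eq
    ... | true  = cong (_* 1) (u (subst T (sym eq) tt))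
    ... | false = trans (*-zeroʳ ∣ S ∣) (sym (*-zeroʳ b))

  card-split : (F : SetFamily n) (v : Fin n) → card F ≡ card (link F v) + card (avoid F v)
  card-split F v = trans (∑-cong (λ S → split (lookup S v) (F S)))
    (trans (∑-+ (λ S → 𝟙 (lookup S v) * 𝟙 (F S)) (𝟙 ∘ avoid F v)) (cong (_+ card (avoid F v)) (sym (card-link F v))))
    where
    split : ∀ x y → 𝟙 y ≡ 𝟙 x * 𝟙 y + 𝟙 (not x ∧ y)
    split true  y = sym (trans (+-identityʳ _) (*-identityˡ (𝟙 y)))
    split false y = refl

  link⊑avoid-shadow : (F : SetFamily n) (v : Fin n) → link F v ⊑ avoid (shadow F) v
  link⊑avoid-shadow F v {S} t = from T-∧ (proj₁ (to (T-∧ {x = not (lookup S v)}) t) , shadow⁺ F v t)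

  lookup-insert : (S : Subset n) {u v : Fin n} → lookup (S [ u ]≔ inside) v ≡ false → u ≢ v × lookup S v ≡ false
  lookup-insert S {u} {v} e with u Fin.≟ v
  ... | yes refl = true≢false (lookup∘update u S inside) e
  ... | no u≢v   = u≢v , trans (sym (lookup∘update′ (u≢v ∘ sym) S inside)) e


  -- Deleting v and then u from a member of F gives the same set as deleting them in the other
  -- order.
  shadow-link⊑link-shadow : (F : SetFamily n) (v : Fin n) → shadow (link F v) ⊑ link (shadow F) v
  shadow-link⊑link-shadow F v {S} t =
    let (u , t₁)    = shadow⁻ (link F v) {S} t
        (u∉S , t₂)  = link⁻ (link F v) {u} {S} t₁
        (v∉Su , t₃) = link⁻ F {v} {S [ u ]≔ inside} t₂
        (u≢v , v∉S) = lookup-insert S {u} {v} v∉Su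
    in link⁺ (shadow F) v∉S (shadow⁺ F u (link⁺ F (trans (lookup∘update′ u≢v S inside) u∉S)
         (subst (T ∘ F) ([]≔-commutes S u v u≢v) t₃)))

  -- Split ∂F by v. The part through v contains a copy of ∂F(v), and the part avoiding v contains
  -- F(v).
  card-shadow≥ : (F : SetFamily n) (v : Fin n) → card (link F v) + card (shadow (link F v)) ≤ card (shadow F)
  card-shadow≥ F v = begin
    card (link F v) + card (shadow (link F v))
      ≡⟨ +-comm (card (link F v)) _ ⟩
    card (shadow (link F v)) + card (link F v)
      ≤⟨ +-mono-≤ (card-mono {F = shadow (link F v)} {link (shadow F) v} (shadow-link⊑link-shadow F v))
                  (card-mono {F = link F v} {avoid (shadow F) v} (link⊑avoid-shadow F v)) ⟩
    card (link (shadow F) v) + card (avoid (shadow F) v)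
      ≡⟨ card-split (shadow F) v ⟨
    card (shadow F) ∎
    where open ≤-Reasoning

  member : (F : SetFamily n) {b : ℕ} → Uniform F (suc b) → 0 < card F → ∃ λ S → ∃ λ v → T (F S) × lookup S v ≡ true
  member F u p = let (S , t) = card-inhabited F p
                     (v , e) = element S (u t)
                 in S , v , t , e

  -- The piecewise linear Kruskal-Katona bound.

  module _ {p q : ℕ} (0<q : 0 < q) (p≤q : p ≤ q) where

    private
      Φ : ℕ → ℕ → ℕ
      Φ = φ p q

    -- No size is assumed of F, since this is applied to links about which nothing is known. Once
    -- |F| ≥ Φ x (b+1) / q, either nontrivial alternative gives the shadow bound. Strictness of the
    -- ratio is what later excludes it in the equality case.
    Dichotomy : ℕ → Set
    Dichotomy b = ∀ {n} (F : SetFamily n) → Uniform F (suc b) → ∀ z → let x = suc b + z in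
      card F ≡ 0 ⊎ Φ x b ≤ q * card (shadow F) ⊎ card F * Φ x b < card (shadow F) * Φ x (suc b)

    HeavyLink : (F : SetFamily n) (x b : ℕ) → Fin n → Set
    HeavyLink F x b v = Φ x (suc b) ≤ q * card (link F v) × Φ x b ≤ q * card (shadow (link F v))

    -- If no link is heavy, every link obeys the ratio bound, and averaging over v transfers it to F.
    heavy-or-ratio : ∀ {b} → Dichotomy b → (F : SetFamily n) → Uniform F (suc (suc b)) → ∀ z → let x = suc b + z in
      card F ≡ 0 ⊎ ∃ (HeavyLink F x b) ⊎ card F * Φ (suc x) (suc b) < card (shadow F) * Φ (suc x) (suc (suc b))
    heavy-or-ratio {b = b} D F u z with card F ℕ.≟ 0
    ... | yes e = inj₁ e
    ... | no ne with any? (λ v → (Φ (suc b + z) (suc b) ℕ.≤? q * card (link F v)) ×-dec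
                               (Φ (suc b + z) b ℕ.≤? q * card (shadow (link F v))))
    ...   | yes h = inj₂ (inj₁ h)
    ...   | no ¬h = inj₂ (inj₂ (*-cancelʳ-< (suc b * Φ x (suc b)) _ _ (begin-strict
      card F * Φ X (suc b) * (suc b * Φ x (suc b))
        ≡⟨ shuffle₁ (card F) (Φ X (suc b)) (suc b) (Φ x (suc b)) ⟩
      card F * (suc b * Φ X (suc b) * Φ x (suc b))
        ≤⟨ *-monoʳ-≤ (card F) (φ-ratio p≤q b z) ⟩
      card F * (suc (suc b) * Φ X (suc (suc b)) * Φ x b)
        ≡⟨ shuffle₂ (card F) (suc (suc b)) (Φ X (suc (suc b))) (Φ x b) ⟩
      suc (suc b) * card F * Φ x b * Φ X (suc (suc b))
        <⟨ *-monoˡ-< (Φ X (suc (suc b))) {{>-nonZero (φ-pos {p} {b = suc (suc b)} 0<q (s≤s (s≤s (m≤m+n b z))))}} averaged ⟩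
      suc b * card (shadow F) * Φ x (suc b) * Φ X (suc (suc b))
        ≡⟨ shuffle₃ (suc b) (card (shadow F)) (Φ x (suc b)) (Φ X (suc (suc b))) ⟩
      card (shadow F) * Φ X (suc (suc b)) * (suc b * Φ x (suc b)) ∎)))
      where
      open ≤-Reasoning
      x X : ℕ
      x = suc b + z
      X = suc x
      shuffle₁ : ∀ f g s h → f * g * (s * h) ≡ f * (s * g * h)
      shuffle₁ = solve-∀
      shuffle₂ : ∀ f s g h → f * (s * g * h) ≡ s * f * h * g
      shuffle₂ = solve-∀
      shuffle₃ : ∀ s f h g → s * f * h * g ≡ f * g * (s * h)
      shuffle₃ = solve-∀
      shuffle₄ : ∀ a c h → a * (c * h) ≡ (a * c) * h
      shuffle₄ = solve-∀
      shuffle₅ : ∀ a c h → h * (a * c) ≡ a * (c * h)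
      shuffle₅ = solve-∀

      ratio : ∀ v → card (link F v) ≡ 0 ⊎ card (link F v) * Φ x b < card (shadow (link F v)) * Φ x (suc b)
      ratio v with D (link F v) (uniform-link {F = F} u v) z
      ... | inj₁ e = inj₁ e
      ... | inj₂ (inj₂ s) = inj₂ s
      ... | inj₂ (inj₁ h) with Φ x (suc b) ℕ.≤? q * card (link F v)
      ...   | yes h′ = ⊥-elim (¬h (v , h′ , h))
      -- The shadow of the link is large but the link itself is light, so the ratio exceeds the
      -- quotient of the two thresholds.
      ...   | no ¬h′ = inj₂ (*-cancelˡ-< q _ _ (begin-strict
        q * (card (link F v) * Φ x b)           ≡⟨ shuffle₄ q (card (link F v)) (Φ x b) ⟩
        (q * card (link F v)) * Φ x b
          <⟨ *-monoˡ-< (Φ x b) {{>-nonZero (φ-pos {p} {b = b} 0<q (≤-trans (n≤1+n b) (m≤m+n (suc b) z)))}} (≰⇒> ¬h′) ⟩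
        Φ x (suc b) * Φ x b                     ≤⟨ *-monoʳ-≤ (Φ x (suc b)) h ⟩
        Φ x (suc b) * (q * card (shadow (link F v))) ≡⟨ shuffle₅ q (card (shadow (link F v))) (Φ x (suc b)) ⟩
        q * (card (shadow (link F v)) * Φ x (suc b)) ∎))

      ratio≤ : ∀ v → card (link F v) * Φ x b ≤ card (shadow (link F v)) * Φ x (suc b)
      ratio≤ v with ratio v
      ... | inj₁ e = ≤-trans (≤-reflexive (cong (_* Φ x b) e)) z≤n
      ... | inj₂ s = <⇒≤ s

      -- One strict term suffices for a strict average; any element of a member of F has a nonempty
      -- link.
      ratio< : ∃ λ v → card (link F v) * Φ x b < card (shadow (link F v)) * Φ x (suc b)
      ratio< with member F u (n≢0⇒n>0 ne)
      ... | S , v , t , e with ratio v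
      ...   | inj₂ s = v , s
      ...   | inj₁ z = ⊥-elim (n≮0 (subst (0 <_) z (card-pos (link F v) (link-delete F v t e))))

      -- The links of F have total size (b+2) |F|, those of ∂F have total size (b+1) |∂F|, and the
      -- latter links contain the shadows of the former.
      averaged : suc (suc b) * card F * Φ x b < suc b * card (shadow F) * Φ x (suc b)
      averaged = begin-strict
        suc (suc b) * card F * Φ x b
          ≡⟨ cong (_* Φ x b) (degree-sum F u) ⟨
        sum (λ v → card (link F v)) * Φ x b
          ≡⟨ *-distribʳ-sum (Φ x b) (λ v → card (link F v)) ⟩
        sum (λ v → card (link F v) * Φ x b)
          <⟨ sum-mono-< ratio≤ (proj₁ ratio<) (proj₂ ratio<) ⟩
        sum (λ v → card (shadow (link F v)) * Φ x (suc b))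
          ≤⟨ sum-mono (λ v → *-monoˡ-≤ (Φ x (suc b)) (card-mono {F = shadow (link F v)} {link (shadow F) v} (shadow-link⊑link-shadow F v))) ⟩
        sum (λ v → card (link (shadow F) v) * Φ x (suc b))
          ≡⟨ *-distribʳ-sum (Φ x (suc b)) (λ v → card (link (shadow F) v)) ⟨
        sum (λ v → card (link (shadow F) v)) * Φ x (suc b)
          ≡⟨ cong (_* Φ x (suc b)) (degree-sum (shadow F) (uniform-shadow {F = F} u)) ⟩
        suc b * card (shadow F) * Φ x (suc b) ∎

    heavy⇒shadow : (F : SetFamily n) {x b : ℕ} {v : Fin n} → HeavyLink F x b v → Φ (suc x) (suc b) ≤ q * card (shadow F)
    heavy⇒shadow F {x} {b} {v} (h₁ , h₂) = begin
      Φ (suc x) (suc b)                                     ≡⟨ φ-pascal p q x b ⟩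
      Φ x (suc b) + Φ x b                                   ≤⟨ +-mono-≤ h₁ h₂ ⟩
      q * card (link F v) + q * card (shadow (link F v))    ≡⟨ *-distribˡ-+ q (card (link F v)) _ ⟨
      q * (card (link F v) + card (shadow (link F v)))      ≤⟨ *-monoʳ-≤ q (card-shadow≥ F v) ⟩
      q * card (shadow F) ∎
      where open ≤-Reasoning

    -- At the bottom, a nonempty 1-uniform family has the empty set in its shadow, and the threshold
    -- there is q · 1.
    dichotomy : ∀ b → Dichotomy b
    dichotomy zero F u z with card F ℕ.≟ 0
    ... | yes e = inj₁ e
    ... | no ne = let (S , v , t , e) = member F u (n≢0⇒n>0 ne) in
      inj₂ (inj₁ (*-monoʳ-≤ q (≤-trans (≤-reflexive (nC0≡1 (suc z)))
        (card-pos (shadow F) (shadow⁺ F v (link-delete F v t e))))))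
    dichotomy (suc b) F u z with heavy-or-ratio (dichotomy b) F u z
    ... | inj₁ e = inj₁ e
    ... | inj₂ (inj₁ (v , h)) = inj₂ (inj₁ (heavy⇒shadow F {suc b + z} {b} {v} h))
    ... | inj₂ (inj₂ s) = inj₂ (inj₂ s)

    empty-light : (F : SetFamily n) {x b : ℕ} → b ≤ x → Φ x b ≤ q * card F → card F ≢ 0
    empty-light F {x} {b} b≤x h e = n≮0 (≤-trans (φ-pos {p} {b = b} 0<q b≤x)
      (≤-trans h (≤-reflexive (trans (cong (q *_) e) (*-zeroʳ q)))))

    ratio⇒shadow : (F : SetFamily n) {x b : ℕ} → b ≤ x → Φ x (suc b) ≤ q * card F →
      card F * Φ x b < card (shadow F) * Φ x (suc b) → Φ x b < q * card (shadow F)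
    ratio⇒shadow F {x} {b} b≤x h s = *-cancelʳ-< (Φ x (suc b)) _ _ (begin-strict
      Φ x b * Φ x (suc b)                     ≡⟨ *-comm (Φ x b) _ ⟩
      Φ x (suc b) * Φ x b                     ≤⟨ *-monoˡ-≤ (Φ x b) h ⟩
      q * card F * Φ x b                      ≡⟨ *-assoc q _ _ ⟩
      q * (card F * Φ x b)                    <⟨ *-monoʳ-< q {{>-nonZero 0<q}} s ⟩
      q * (card (shadow F) * Φ x (suc b))     ≡⟨ *-assoc q _ _ ⟨
      q * card (shadow F) * Φ x (suc b)       ∎)
      where open ≤-Reasoning

    kruskal-katona : (F : SetFamily n) {x b : ℕ} → Uniform F (suc b) → suc b ≤ x →
      Φ x (suc b) ≤ q * card F → Φ x b ≤ q * card (shadow F)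
    kruskal-katona F {x} {b} u b≤x h with m≤n⇒∃[o]m+o≡n b≤x
    ... | z , refl with dichotomy b F u z
    ...   | inj₁ e = ⊥-elim (empty-light F {b = suc b} b≤x h e)
    ...   | inj₂ (inj₁ h′) = h′
    ...   | inj₂ (inj₂ s) = <⇒≤ (ratio⇒shadow F (≤-trans (n≤1+n b) b≤x) h s)

    -- Equality would have to pass from F to a heavy link, and from there down to a 1-uniform link
    -- of size exactly x + p / q, which is not an integer. The descent starts from uniformity at
    -- least 2: every nonempty 1-uniform family attains the bound.
    kruskal-katona-< : 0 < p → p < q → ∀ b (F : SetFamily n) {x : ℕ} → Uniform F (suc (suc b)) → suc (suc b) ≤ x →
      Φ x (suc (suc b)) ≤ q * card F → Φ x (suc b) < q * card (shadow F)
    kruskal-katona-< 0<p p<q b F u b≤x h with m≤n⇒∃[o]m+o≡n b≤x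
    ... | z , refl with heavy-or-ratio (dichotomy b) F u z
    ...   | inj₁ e = ⊥-elim (empty-light F {b = suc (suc b)} b≤x h e)
    ...   | inj₂ (inj₂ s) = ratio⇒shadow F (≤-trans (n≤1+n (suc b)) b≤x) h s
    ...   | inj₂ (inj₁ (v , h₁ , h₂)) = begin-strict
      Φ (suc x) (suc b)                                     ≡⟨ φ-pascal p q x b ⟩
      Φ x (suc b) + Φ x b                                   <⟨ strict-sum b h₁ h₂ u ⟩
      q * card (link F v) + q * card (shadow (link F v))    ≡⟨ *-distribˡ-+ q (card (link F v)) _ ⟨
      q * (card (link F v) + card (shadow (link F v)))      ≤⟨ *-monoʳ-≤ q (card-shadow≥ F v) ⟩
      q * card (shadow F) ∎
      where
      open ≤-Reasoning
      x : ℕ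
      x = suc b + z
      strict-sum : ∀ b → Φ (suc b + z) (suc b) ≤ q * card (link F v) → Φ (suc b + z) b ≤ q * card (shadow (link F v)) →
        Uniform F (suc (suc b)) →
        Φ (suc b + z) (suc b) + Φ (suc b + z) b < q * card (link F v) + q * card (shadow (link F v))
      strict-sum (suc b) h₁ h₂ u = +-mono-≤-< h₁ (kruskal-katona-< 0<p p<q b (link F v) (uniform-link {F = F} u v) (m≤m+n _ z) h₁)
      -- Here Φ x 1 = q x + p is not a multiple of q.
      strict-sum zero h₁ h₂ u = +-mono-<-≤ (≤∧≢⇒< h₁ not-multiple) h₂
        where
        value : Φ (suc z) 1 ≡ q * (suc z C 1) + p
        value = cong (q * (suc z C 1) +_) (trans (cong (p *_) (nC0≡1 (suc z))) (*-identityʳ p))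
        not-multiple : Φ (suc z) 1 ≢ q * card (link F v)
        not-multiple e = <-irrefl refl (<-≤-trans below (*-cancelˡ-< q _ _ above))
          where
          above : q * (suc z C 1) < q * card (link F v)
          above = subst (q * (suc z C 1) <_) (trans (sym value) e) (m<m+n _ 0<p)
          below : card (link F v) < suc (suc z C 1)
          below = *-cancelˡ-< q _ _ (subst₂ _<_ (trans (sym value) e) (trans (+-comm _ q) (sym (*-suc q _))) (+-monoʳ-< _ p<q))

  -- Iterated shadows.

  shadowₙ : ℕ → SetFamily n → SetFamily n
  shadowₙ zero    F = F
  shadowₙ (suc i) F = shadowₙ i (shadow F)

  uniform-shadowₙ : ∀ i {b} (F : SetFamily n) → Uniform F (i + b) → Uniform (shadowₙ i F) b
  uniform-shadowₙ zero    F u = u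
  uniform-shadowₙ (suc i) F u = uniform-shadowₙ i (shadow F) (uniform-shadow {F = F} u)

  -- The conclusion for ∂F has the form of the hypothesis one level lower, with the same x and the
  -- same p / q, so the bound iterates without loss.
  kruskal-katonaₙ : ∀ {p q} → 0 < q → p ≤ q → ∀ i {b} (F : SetFamily n) {x : ℕ} → Uniform F (i + b) → i + b ≤ x →
    φ p q x (i + b) ≤ q * card F → φ p q x b ≤ q * card (shadowₙ i F)
  kruskal-katonaₙ 0<q p≤q zero    F u b≤x h = h
  kruskal-katonaₙ 0<q p≤q (suc i) F u b≤x h =
    kruskal-katonaₙ 0<q p≤q i (shadow F) (uniform-shadow {F = F} u) (≤-trans (n≤1+n _) b≤x)
      (kruskal-katona 0<q p≤q F u b≤x h)

  -- The strict inequality is gained in the last deletion. It starts from sets of size at least 2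
  -- because the target level is at least 1.
  kruskal-katonaₙ-< : ∀ {p q} → 0 < p → p < q → ∀ i {b} (F : SetFamily n) {x : ℕ} →
    Uniform F (suc i + suc b) → suc i + suc b ≤ x →
    φ p q x (suc i + suc b) ≤ q * card F → φ p q x (suc b) < q * card (shadowₙ (suc i) F)
  kruskal-katonaₙ-< {p = p} {q} 0<p p<q zero {b} F u b≤x h = kruskal-katona-< (<-trans 0<p p<q) (<⇒≤ p<q) 0<p p<q b F u b≤x h
  kruskal-katonaₙ-< 0<p p<q (suc i) F u b≤x h =
    kruskal-katonaₙ-< 0<p p<q i (shadow F) (uniform-shadow {F = F} u) (≤-trans (n≤1+n _) b≤x)
      (kruskal-katona (<-trans 0<p p<q) (<⇒≤ p<q) F u b≤x h)

  φ-zero : ∀ x b → φ 0 1 x b ≡ x C b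
  φ-zero x zero    = *-identityˡ (x C 0)
  φ-zero x (suc b) = trans (+-identityʳ _) (*-identityˡ (x C suc b))

  kruskal-katonaₙ-C : ∀ i {b} (F : SetFamily n) {x : ℕ} → Uniform F (i + b) → i + b ≤ x →
    x C (i + b) ≤ card F → x C b ≤ card (shadowₙ i F)
  kruskal-katonaₙ-C i {b} F {x} u b≤x h = subst₂ _≤_ (φ-zero x b) (*-identityˡ _)
    (kruskal-katonaₙ {p = 0} ≤-refl z≤n i F u b≤x (subst₂ _≤_ (sym (φ-zero x (i + b))) (sym (*-identityˡ _)) h))

  -- Equality in the shadow bound.

  ∣delete∣ : (S : Subset n) (v : Fin n) → lookup S v ≡ true → ∣ S ∣ ≡ suc ∣ S [ v ]≔ outside ∣
  ∣delete∣ S v e = trans (cong ∣_∣ (sym (reinsert S v e))) (∣insert∣ (S [ v ]≔ outside) v (lookup∘update v S outside))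

  -- Some link F(v) is heavy, and then |F(v)| + |∂F(v)| ≤ |∂F| leaves no slack. The link is
  -- therefore extremal one level lower and has a small support X, and X ∪ {v} supports F. That the
  -- support has exactly x elements follows later by counting.
  support-size : ∀ b (F : SetFamily n) {x} → Uniform F (suc b) → suc b ≤ x → card F ≡ x C suc b →
    card (shadow F) ≤ x C b → ∃ λ X → ∣ X ∣ ≤ x × (∀ {S} → T (F S) → ∀ w → lookup S w ≡ true → lookup X w ≡ true)
  support-size {n} zero F {x} u b≤x eF _ = X , bound , covers
    where
    X : Subset n
    -- For singletons the support is the set of vertices of positive degree, at most the degree sum,
    -- which is |F| = x.
    X = tabulate λ v → 0 <ᵇ card (link F v)
    𝟙-positive : ∀ m → 𝟙 (0 <ᵇ m) ≤ m
    𝟙-positive zero    = z≤n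
    𝟙-positive (suc m) = s≤s z≤n
    bound : ∣ X ∣ ≤ x
    bound = begin
      ∣ X ∣                                  ≡⟨ sum-lookup X ⟨
      sum (λ v → 𝟙 (lookup X v))
        ≡⟨ sum-cong-≗ {n} (λ v → cong 𝟙 (lookup∘tabulate (λ v → 0 <ᵇ card (link F v)) v)) ⟩
      sum (λ v → 𝟙 (0 <ᵇ card (link F v)))   ≤⟨ sum-mono (λ v → 𝟙-positive (card (link F v))) ⟩
      sum (λ v → card (link F v))            ≡⟨ degree-sum F u ⟩
      1 * card F                             ≡⟨ cong (1 *_) eF ⟩
      1 * (x C 1)                            ≡⟨ trans (+-identityʳ _) (nC1≡n x) ⟩
      x ∎
      where
      open ≤-Reasoning
    covers : ∀ {S} → T (F S) → ∀ w → lookup S w ≡ true → lookup X w ≡ true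
    covers {S} t w e = trans (lookup∘tabulate _ w) (to T-≡ (<⇒<ᵇ (card-pos (link F w) (link-delete F w t e))))
  support-size {n} (suc b) F u b≤x eF e∂ with m≤n⇒∃[o]m+o≡n b≤x
  ... | z , refl with heavy-or-ratio {0} {1} ≤-refl z≤n (dichotomy ≤-refl z≤n b) F u z
  ...   | inj₁ e = ⊥-elim (n≮0 (subst (0 <_) (trans (sym eF) e) (C-pos b≤x)))
  -- At t = 0 a strictly large ratio contradicts the prescribed |F| and the upper bound on |∂F|.
  ...   | inj₂ (inj₂ s) = ⊥-elim (<-irrefl refl (<-≤-trans s (begin
      card (shadow F) * φ 0 1 X (suc (suc b))
        ≡⟨ cong (card (shadow F) *_) (trans (φ-zero X (suc (suc b))) (sym eF)) ⟩
      card (shadow F) * card F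
        ≤⟨ *-monoˡ-≤ (card F) (≤-trans e∂ (≤-reflexive (sym (φ-zero X (suc b))))) ⟩
      φ 0 1 X (suc b) * card F
        ≡⟨ *-comm _ (card F) ⟩
      card F * φ 0 1 X (suc b) ∎)))
      where
      open ≤-Reasoning
      X = suc (suc b + z)
  ...   | inj₂ (inj₁ (v , h₁ , h₂)) = conclude (support-size b (link F v) uL (m≤m+n (suc b) z) card-L card-∂L)
      where
      x : ℕ
      x = suc b + z
      L : SetFamily n
      L = link F v
      uL = uniform-link {F = F} u v
      L≥ : x C suc b ≤ card L
      L≥ = subst₂ _≤_ (φ-zero x (suc b)) (*-identityˡ _) h₁
      ∂L≥ : x C b ≤ card (shadow L)
      ∂L≥ = subst₂ _≤_ (φ-zero x b) (*-identityˡ _) h₂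
      total : card L + card (shadow L) ≤ (x C b) + (x C suc b)
      total = ≤-trans (card-shadow≥ F v) (≤-trans e∂ (≤-reflexive (pascal x b)))
      card-L : card L ≡ x C suc b
      card-L = ≤-antisym (+-cancelˡ-≤ (x C b) _ _ (≤-trans (≤-reflexive (+-comm (x C b) (card L)))
        (≤-trans (+-monoʳ-≤ (card L) ∂L≥) total))) L≥
      card-∂L : card (shadow L) ≤ x C b
      card-∂L = +-cancelʳ-≤ (x C suc b) _ _ (≤-trans (≤-reflexive (+-comm (card (shadow L)) _))
        (≤-trans (+-monoˡ-≤ (card (shadow L)) L≥) total))
      -- At least C(x,b) members of ∂F contain v, so at most C(x,b+1) avoid it. The link lies among
      -- these and is already that large.
      avoid⊑link : avoid (shadow F) v ⊑ L
      avoid⊑link = card-⊑-≡ {F = L} {avoid (shadow F) v} (link⊑avoid-shadow F v) (+-cancelˡ-≤ (x C b) _ _ (begin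
        (x C b) + card (avoid (shadow F) v)
          ≤⟨ +-monoˡ-≤ (card (avoid (shadow F) v)) (≤-trans ∂L≥ (card-mono {F = shadow L} {link (shadow F) v} (shadow-link⊑link-shadow F v))) ⟩
        card (link (shadow F) v) + card (avoid (shadow F) v)
          ≡⟨ card-split (shadow F) v ⟨
        card (shadow F)      ≤⟨ e∂ ⟩
        (suc x C suc b)      ≡⟨ pascal x b ⟩
        (x C b) + (x C suc b)  ≤⟨ +-monoʳ-≤ (x C b) L≥ ⟩
        (x C b) + card L ∎))
        where open ≤-Reasoning
      conclude : (∃ λ X → ∣ X ∣ ≤ x × (∀ {S} → T (L S) → ∀ w → lookup S w ≡ true → lookup X w ≡ true)) →
        ∃ λ X → ∣ X ∣ ≤ suc x × (∀ {S} → T (F S) → ∀ w → lookup S w ≡ true → lookup X w ≡ true)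
      conclude (X , bound , covers) = X [ v ]≔ inside , ≤-trans (∣insert∣≤ X v) (s≤s bound) , covers′
        where
        covers′ : ∀ {S} → T (F S) → ∀ w → lookup S w ≡ true → lookup (X [ v ]≔ inside) w ≡ true
        covers′ {S} t w w∈S with w Fin.≟ v
        ... | yes refl = lookup∘update v X inside
        ... | no w≢v = trans (lookup∘update′ w≢v X inside) w∈X
          where
          w∈X : lookup X w ≡ true
          w∈X with lookup S v in eq
          ... | true  = covers (link-delete F v t eq) w (trans (lookup∘update′ w≢v S outside) w∈S)
          -- A member S avoiding v is not seen by the link. Delete some y ≠ w from it, which is
          -- possible as |S| ≥ 2: what remains is in ∂F, avoids v, hence lies in the link, and still
          -- contains w.
          ... | false = let
                (y , y∈S′) = element (S [ w ]≔ outside) (suc-injective (trans (sym (∣delete∣ S w w∈S)) (u t)))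
                y≢w : y ≢ w
                y≢w e = true≢false (subst (λ i → lookup (S [ w ]≔ outside) i ≡ true) e y∈S′) (lookup∘update w S outside)
                y∈S = trans (sym (lookup∘update′ y≢w S outside)) y∈S′
                y≢v : y ≢ v
                y≢v e = true≢false (subst (λ i → lookup S i ≡ true) e y∈S) eq
                v∉ = trans (lookup∘update′ (y≢v ∘ sym) S outside) eq
              in covers (avoid⊑link {S [ y ]≔ outside} (from T-∧ (from T-not-≡ v∉ , shadow⁺ F y (link-delete F y t y∈S)))) w
                   (trans (lookup∘update′ (y≢w ∘ sym) S outside) w∈S)

  -- Contrapositive of the iterated bound with t = 1 / C(x,j+k): a single set beyond C(x,j+k+1)
  -- raises t from 0 to this value and the shadow strictly above C(x,k+1). This carries extremality
  -- of the last shadow back to the first one.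
  small-shadow : ∀ j {k} (G : SetFamily n) {x} → Uniform G (j + suc k) → j + suc k ≤ x →
    card (shadowₙ j G) ≤ x C suc k → card G ≤ x C (j + suc k)
  small-shadow j {k} G {x} u le s = ≮⇒≥ λ big → <-irrefl refl (begin-strict
    q * (x C suc k)               <⟨ m<m+n _ (≤-trans (C-pos k≤x) (≤-reflexive (sym (*-identityˡ _)))) ⟩
    q * (x C suc k) + 1 * (x C k)   ≤⟨ kruskal-katonaₙ {p = 1} {q} q>0 q>0 j G u le (heavy big) ⟩
    q * card (shadowₙ j G)      ≤⟨ *-monoʳ-≤ q s ⟩
    q * (x C suc k) ∎)
    where
    open ≤-Reasoning
    q = x C (j + k)
    k≤x : k ≤ x
    k≤x = ≤-trans (n≤1+n k) (≤-trans (m≤n+m (suc k) j) le)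
    q>0 : 0 < q
    q>0 = C-pos (≤-trans (+-monoʳ-≤ j (n≤1+n k)) le)
    heavy : x C (j + suc k) < card G → φ 1 q x (j + suc k) ≤ q * card G
    heavy big = begin
      φ 1 q x (j + suc k)                   ≡⟨ cong (φ 1 q x) (+-suc j k) ⟩
      q * (x C suc (j + k)) + 1 * q         ≡⟨ regroup q (x C suc (j + k)) ⟩
      q * suc (x C suc (j + k))             ≡⟨ cong (λ i → q * suc (x C i)) (+-suc j k) ⟨
      q * suc (x C (j + suc k))             ≤⟨ *-monoʳ-≤ q big ⟩
      q * card G ∎
      where
      regroup : ∀ q a → q * a + 1 * q ≡ q * suc a
      regroup = solve-∀

  support-sizeₙ : ∀ i {k} (F : SetFamily n) {x} → Uniform F (suc i + suc k) → suc i + suc k ≤ x →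
    card F ≡ x C (suc i + suc k) → card (shadowₙ (suc i) F) ≤ x C suc k →
    ∃ λ X → ∣ X ∣ ≤ x × (∀ {S} → T (F S) → ∀ w → lookup S w ≡ true → lookup X w ≡ true)
  support-sizeₙ i {k} F u le eF e∂ = support-size (i + suc k) F u le eF
    (small-shadow i (shadow F) (uniform-shadow {F = F} u) (≤-trans (n≤1+n _) le) e∂)

  -- Concavity of the curve through (C(x,b), C(x,k)).

  absorption-suc : ∀ k z → suc z * (suc (k + z) C k) ≡ suc (k + z) * ((k + z) C k)
  absorption-suc zero z = cong (suc z *_) (trans (nC0≡1 (suc z)) (sym (nC0≡1 z)))
  absorption-suc (suc k) z = begin
    suc z * (suc (suc k + z) C suc k)
      ≡⟨ cong (suc z *_) (pascal (suc k + z) k) ⟩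
    suc z * (((suc k + z) C k) + ((suc k + z) C suc k))
      ≡⟨ *-distribˡ-+ (suc z) ((suc k + z) C k) _ ⟩
    suc z * ((suc k + z) C k) + suc z * ((suc k + z) C suc k)
      ≡⟨ cong (_+ suc z * ((suc k + z) C suc k)) (subst (λ x → suc z * (x C k) ≡ suc k * (x C suc k)) (+-suc k z) (sym (absorption-+ k (suc z)))) ⟩
    suc k * ((suc k + z) C suc k) + suc z * ((suc k + z) C suc k)
      ≡⟨ *-distribʳ-+ ((suc k + z) C suc k) (suc k) (suc z) ⟨
    (suc k + suc z) * ((suc k + z) C suc k)
      ≡⟨ cong (_* ((suc k + z) C suc k)) (+-suc (suc k) z) ⟩
    suc (suc k + z) * ((suc k + z) C suc k) ∎
    where open ≡-Reasoning

  -- C(y+1,k) / C(y,k) = (y+1) / (y+1-k) grows with k, so C(y,κ) / C(y,β) strictly decreases in y.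
  -- By Pascal's rule this quotient is the slope between the points (C(x,β+1), C(x,κ+1)) at x = y
  -- and x = y + 1, so its decrease is strict concavity.
  C-ratio-suc : ∀ {κ β y} → κ < β → β ≤ y → (y C β) * (suc y C κ) < (y C κ) * (suc y C β)
  C-ratio-suc {κ} {β} {y} κ<β β≤y = *-cancelˡ-< (suc z * suc z′) _ _ (begin-strict
    suc z * suc z′ * (yβ * (suc y C κ))   ≡⟨ shuffle₁ (suc z) (suc z′) yβ (suc y C κ) ⟩
    suc z * yβ * (suc z′ * (suc y C κ))   ≡⟨ cong (suc z * yβ *_) absorb-κ ⟩
    suc z * yβ * (suc y * yκ)             ≡⟨ shuffle₂ (suc z) yβ (suc y) yκ ⟩
    suc z * (suc y * yβ * yκ)
      <⟨ *-monoˡ-< (suc y * yβ * yκ) {{>-nonZero (*-mono-≤ (*-mono-≤ {1} {suc y} (s≤s z≤n) (C-pos β≤y)) (C-pos κ≤y))}} z<z′ ⟩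
    suc z′ * (suc y * yβ * yκ)            ≡⟨ shuffle₃ (suc z′) (suc y) yβ yκ ⟩
    suc z′ * yκ * (suc y * yβ)            ≡⟨ cong (suc z′ * yκ *_) absorb-β ⟨
    suc z′ * yκ * (suc z * (suc y C β))   ≡⟨ shuffle₄ (suc z′) yκ (suc z) (suc y C β) ⟩
    suc z * suc z′ * (yκ * (suc y C β))   ∎)
    where
    open ≤-Reasoning
    κ≤y = ≤-trans (<⇒≤ κ<β) β≤y
    z  = y ∸ β
    z′ = y ∸ κ
    yβ = y C β
    yκ = y C κ
    z<z′ : suc z < suc z′
    z<z′ = s≤s (∸-monoʳ-< κ<β β≤y)
    absorb : ∀ {k} → k ≤ y → suc (y ∸ k) * (suc y C k) ≡ suc y * (y C k)
    absorb {k} k≤y = subst (λ x → suc (y ∸ k) * (suc x C k) ≡ suc x * (x C k)) (m+[n∸m]≡n k≤y) (absorption-suc k (y ∸ k))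
    absorb-κ = absorb κ≤y
    absorb-β = absorb β≤y
    shuffle₁ : ∀ a b c d → a * b * (c * d) ≡ a * c * (b * d)
    shuffle₁ = solve-∀
    shuffle₂ : ∀ a b c d → a * b * (c * d) ≡ a * (c * b * d)
    shuffle₂ = solve-∀
    shuffle₃ : ∀ a b c d → a * (b * c * d) ≡ a * d * (b * c)
    shuffle₃ = solve-∀
    shuffle₄ : ∀ a b c d → a * b * (c * d) ≡ c * a * (b * d)
    shuffle₄ = solve-∀

  C-ratio-≤ : ∀ {κ β y} → κ < β → β ≤ y → ∀ e → (y C β) * ((e + y) C κ) ≤ (y C κ) * ((e + y) C β)
  C-ratio-< : ∀ {κ β y} → κ < β → β ≤ y → ∀ e → (y C β) * ((suc e + y) C κ) < (y C κ) * ((suc e + y) C β)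

  C-ratio-≤ {κ} {β} {y} κ<β β≤y zero    = ≤-reflexive (*-comm (y C β) _)
  C-ratio-≤ κ<β β≤y (suc e) = <⇒≤ (C-ratio-< κ<β β≤y e)
  C-ratio-< {κ} {β} {y} κ<β β≤y e = *-cancelʳ-< (x C β) _ _ (begin-strict
    (y C β) * (suc x C κ) * (x C β)    ≡⟨ shuffle₁ (y C β) (suc x C κ) (x C β) ⟩
    (y C β) * ((x C β) * (suc x C κ))
      <⟨ *-monoʳ-< (y C β) {{>-nonZero (C-pos β≤y)}} (C-ratio-suc κ<β (≤-trans β≤y (m≤n+m y e))) ⟩
    (y C β) * ((x C κ) * (suc x C β))  ≡⟨ *-assoc (y C β) _ _ ⟨
    (y C β) * (x C κ) * (suc x C β)    ≤⟨ *-monoˡ-≤ (suc x C β) (C-ratio-≤ κ<β β≤y e) ⟩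
    (y C κ) * (x C β) * (suc x C β)    ≡⟨ shuffle₂ (y C κ) (x C β) (suc x C β) ⟩
    (y C κ) * (suc x C β) * (x C β)    ∎)
    where
    open ≤-Reasoning
    x = e + y
    shuffle₁ : ∀ a b c → a * b * c ≡ a * (c * b)
    shuffle₁ = solve-∀
    shuffle₂ : ∀ a b c → a * b * c ≡ a * c * b
    shuffle₂ = solve-∀

  -- This and the next two lemmas: the line through (C(x,β+1), C(x,κ+1)) of slope
  -- C(x,κ) / C(x,β) lies above all the points (C(y,β+1), C(y,κ+1)).
  supporting-right : ∀ {κ β x} → κ < β → β ≤ x → ∀ e → let d = e + x in
    (x C β) * (d C suc κ) + (x C κ) * (x C suc β) ≤ (x C β) * (x C suc κ) + (x C κ) * (d C suc β)
  supporting-right κ<β β≤x zero = ≤-refl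
  supporting-right {κ} {β} {x} κ<β β≤x (suc e) = begin
    Q * (suc d C suc κ) + P * (x C suc β)               ≡⟨ cong (λ a → Q * a + P * (x C suc β)) (pascal d κ) ⟩
    Q * ((d C κ) + (d C suc κ)) + P * (x C suc β)        ≡⟨ regroup₁ Q (d C κ) (d C suc κ) (P * (x C suc β)) ⟩
    Q * (d C κ) + (Q * (d C suc κ) + P * (x C suc β))
      ≤⟨ +-mono-≤ (C-ratio-≤ κ<β β≤x e) (supporting-right κ<β β≤x e) ⟩
    P * (d C β) + (Q * (x C suc κ) + P * (d C suc β))    ≡⟨ regroup₂ P (d C β) (Q * (x C suc κ)) (d C suc β) ⟩
    Q * (x C suc κ) + P * ((d C β) + (d C suc β))        ≡⟨ cong (λ a → Q * (x C suc κ) + P * a) (pascal d β) ⟨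
    Q * (x C suc κ) + P * (suc d C suc β)               ∎
    where
    open ≤-Reasoning
    d = e + x
    P = x C κ
    Q = x C β
    regroup₁ : ∀ q a b c → q * (a + b) + c ≡ q * a + (q * b + c)
    regroup₁ = solve-∀
    regroup₂ : ∀ p a b c → p * a + (b + p * c) ≡ b + p * (a + c)
    regroup₂ = solve-∀

  supporting-left-≤ : ∀ {κ β a} → κ < β → β ≤ a → ∀ e → let x = e + a in
    (x C β) * (a C suc κ) + (x C κ) * (x C suc β) ≤ (x C β) * (x C suc κ) + (x C κ) * (a C suc β)
  supporting-left-< : ∀ {κ β a} → κ < β → β ≤ a → ∀ e → let x = suc e + a in
    (x C β) * (a C suc κ) + (x C κ) * (x C suc β) < (x C β) * (x C suc κ) + (x C κ) * (a C suc β)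

  supporting-left-≤ κ<β β≤a zero    = ≤-refl
  supporting-left-≤ κ<β β≤a (suc e) = <⇒≤ (supporting-left-< κ<β β≤a e)
  supporting-left-< {κ} {β} {a} κ<β β≤a e = +-cancelˡ-< (P * (a C β)) _ _ (begin-strict
    P * (a C β) + (Q * (a C suc κ) + P * (x C suc β))
      <⟨ +-monoˡ-< (Q * (a C suc κ) + P * (x C suc β)) (subst₂ _<_ (*-comm (a C β) P) (*-comm (a C κ) Q) (C-ratio-< κ<β β≤a e)) ⟩
    Q * (a C κ) + (Q * (a C suc κ) + P * (x C suc β))
      ≡⟨ regroup₁ Q (a C κ) (a C suc κ) (P * (x C suc β)) ⟩
    Q * ((a C κ) + (a C suc κ)) + P * (x C suc β)
      ≡⟨ cong (λ c → Q * c + P * (x C suc β)) (pascal a κ) ⟨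
    Q * (suc a C suc κ) + P * (x C suc β)
      ≤⟨ subst (λ x → (x C β) * (suc a C suc κ) + (x C κ) * (x C suc β) ≤ (x C β) * (x C suc κ) + (x C κ) * (suc a C suc β))
               (+-suc e a) (supporting-left-≤ κ<β (≤-trans β≤a (n≤1+n a)) e) ⟩
    Q * (x C suc κ) + P * (suc a C suc β)
      ≡⟨ cong (λ c → Q * (x C suc κ) + P * c) (pascal a β) ⟩
    Q * (x C suc κ) + P * ((a C β) + (a C suc β))
      ≡⟨ regroup₂ (Q * (x C suc κ)) P (a C β) (a C suc β) ⟩
    P * (a C β) + (Q * (x C suc κ) + P * (a C suc β)) ∎)
    where
    open ≤-Reasoning
    x = suc e + a
    P = x C κ
    Q = x C β
    regroup₁ : ∀ q a b c → q * a + (q * b + c) ≡ q * (a + b) + c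
    regroup₁ = solve-∀
    regroup₂ : ∀ c p a b → c + p * (a + b) ≡ p * a + (c + p * b)
    regroup₂ = solve-∀

  -- A discrete intermediate value argument, which finds the linear piece containing |F|.
  locate : (f : ℕ → ℕ) → ∀ {m} a e → f a ≤ m → m < f (e + a) →
    ∃ λ i → i < e × f (i + a) ≤ m × m < f (suc i + a)
  locate f a zero    le lt = ⊥-elim (<-irrefl refl (≤-<-trans le lt))
  locate f {m} a (suc e) le lt with f (e + a) ℕ.≤? m
  ... | yes le′ = e , ≤-refl , le′ , lt
  ... | no ¬le with locate f a e le (≰⇒> ¬le)
  ...   | i , i<e , l , r = i , ≤-trans i<e (n≤1+n e) , l , r

  -- Writing k for κ + 1, the point (|F|, |∂F|) lies strictly above the chord from
  -- (C(a,b), C(a,k)) to (C(d,b), C(d,k)); u and w are the distances of |F| to the ends.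
  above-chord : ∀ i {κ} (F : SetFamily n) {a d u w} → let b = suc i + suc κ in
    Uniform F b → b ≤ a → a ≤ d → card F ≡ (a C b) + w → d C b ≡ card F + u → 0 < u → 0 < w →
    u * (a C suc κ) + w * (d C suc κ) < (u + w) * card (shadowₙ (suc i) F)
  above-chord i {κ} F {a} {d} {u} {w} uF b≤a a≤d ew eu 0<u 0<w
    with m≤n⇒∃[o]m+o≡n a≤d
  ... | e , refl with locate (_C (suc i + suc κ)) a e
        (≤-trans (m≤m+n _ w) (≤-reflexive (sym ew)))
        (subst (λ d → card F < d C (suc i + suc κ)) (+-comm a e) (<-≤-trans (m<m+n (card F) 0<u) (≤-reflexive (sym eu))))
  ... | j , j<e , xb≤m , m<x+1b with m≤n⇒∃[o]m+o≡n xb≤m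
  ...   | p , ep = *-cancelˡ-< Q _ _ (+-cancelʳ-< ((u + w) * (P * cx)) _ _ (finish p refl))
    where
    open ≤-Reasoning
    β = i + suc κ
    x = j + a
    -- P / Q is the slope of the piece from x to x + 1. Q is also the denominator of t, so |F| =
    -- C(x,b) + p makes the size hypothesis `heavy` an equality.
    P = x C κ
    Q = x C β
    m = card F
    s = card (shadowₙ (suc i) F)
    cx = x C suc β
    sx = x C suc κ
    sa = a C suc κ
    sd = (a + e) C suc κ
    ca = a C suc β
    cd = (a + e) C suc β
    b≤x : suc β ≤ x
    b≤x = ≤-trans b≤a (m≤n+m a j)
    β≤x = ≤-trans (n≤1+n β) b≤x
    κ<β : κ < β
    κ<β = m≤n+m (suc κ) i
    p<Q : p < Q
    p<Q = +-cancelˡ-< cx _ _ (begin-strict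
      cx + p          ≡⟨ ep ⟩
      m               <⟨ m<x+1b ⟩
      suc x C suc β   ≡⟨ pascal x β ⟩
      Q + cx          ≡⟨ +-comm Q cx ⟩
      cx + Q          ∎)
    heavy : φ p Q x (suc β) ≤ Q * m
    heavy = ≤-reflexive (trans (cong (Q * cx +_) (*-comm p Q)) (trans (sym (*-distribˡ-+ Q cx p)) (cong (Q *_) ep)))
    0<Q : 0 < Q
    0<Q = C-pos β≤x
    kk : Q * sx + p * P ≤ Q * s
    kk = kruskal-katonaₙ {p = p} 0<Q (<⇒≤ p<Q) (suc i) F uF b≤x heavy
    right : Q * sd + P * cx ≤ Q * sx + P * cd
    right with m≤n⇒∃[o]m+o≡n (≤-trans (n≤1+n j) j<e)
    ... | o , refl = subst (λ d → Q * (d C suc κ) + P * cx ≤ Q * sx + P * (d C suc β)) (reassoc o j a) (supporting-right κ<β β≤x o)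
      where
      reassoc : ∀ o j a → o + (j + a) ≡ a + (j + o)
      reassoc = solve-∀
    β≤a = ≤-trans (n≤1+n β) b≤a
    u>0 = >-nonZero 0<u
    balance : u * ca + w * cd ≡ (u + w) * (cx + p)
    balance = trans (cong (λ c → u * ca + w * c) (trans eu (cong (_+ u) ew)))
      (trans (regroup u w ca) (cong ((u + w) *_) (trans (sym ew) (sym ep))))
      where
      regroup : ∀ u w c → u * c + w * (c + w + u) ≡ (u + w) * (c + w)
      regroup = solve-∀
    collect : ∀ q u w a d r → q * (u * a + w * d) + (u + w) * r ≡ u * (q * a + r) + w * (q * d + r)
    collect = solve-∀
    spread : ∀ q u w s P a d → u * (q * s + P * a) + w * (q * s + P * d) ≡ (u + w) * (q * s) + P * (u * a + w * d)
    spread = solve-∀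
    expand : ∀ q u w s P c p → (u + w) * (q * s) + P * ((u + w) * (c + p)) ≡ (u + w) * (q * s + p * P) + (u + w) * (P * c)
    expand = solve-∀
    assemble : u * (Q * sx + P * ca) + w * (Q * sx + P * cd) ≡ (u + w) * (Q * sx + p * P) + (u + w) * (P * cx)
    assemble = trans (spread Q u w sx P ca cd) (trans (cong (λ c → (u + w) * (Q * sx) + P * c) balance) (expand Q u w sx P cx p))
    reorder : ∀ u q s → u * (q * s) ≡ q * (u * s)
    reorder = solve-∀
    -- For p > 0 the shadow bound is strict. For p = 0 the size of F is the breakpoint at x, which
    -- is not the left end because w > 0, and the left end lies strictly below the supporting line
    -- at x.
    finish : ∀ p′ → p ≡ p′ → Q * (u * sa + w * sd) + (u + w) * (P * cx) < Q * ((u + w) * s) + (u + w) * (P * cx)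
    finish (suc _) refl = begin-strict
      Q * (u * sa + w * sd) + (u + w) * (P * cx)
        ≡⟨ collect Q u w sa sd (P * cx) ⟩
      u * (Q * sa + P * cx) + w * (Q * sd + P * cx)
        ≤⟨ +-mono-≤ (*-monoʳ-≤ u (supporting-left-≤ κ<β β≤a j)) (*-monoʳ-≤ w right) ⟩
      u * (Q * sx + P * ca) + w * (Q * sx + P * cd)
        ≡⟨ assemble ⟩
      (u + w) * (Q * sx + p * P) + (u + w) * (P * cx)
        <⟨ +-monoˡ-< ((u + w) * (P * cx)) (*-monoʳ-< (u + w) {{>-nonZero (≤-trans 0<u (m≤m+n u w))}} (kruskal-katonaₙ-< (s≤s z≤n) p<Q i F uF b≤x heavy)) ⟩
      (u + w) * (Q * s) + (u + w) * (P * cx)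
        ≡⟨ cong (_+ (u + w) * (P * cx)) (reorder (u + w) Q s) ⟩
      Q * ((u + w) * s) + (u + w) * (P * cx) ∎
    finish zero refl = begin-strict
      Q * (u * sa + w * sd) + (u + w) * (P * cx)
        ≡⟨ collect Q u w sa sd (P * cx) ⟩
      u * (Q * sa + P * cx) + w * (Q * sd + P * cx)
        <⟨ +-mono-<-≤ (*-monoʳ-< u {{u>0}} (left j refl)) (*-monoʳ-≤ w right) ⟩
      u * (Q * sx + P * ca) + w * (Q * sx + P * cd)
        ≡⟨ assemble ⟩
      (u + w) * (Q * sx + p * P) + (u + w) * (P * cx)
        ≤⟨ +-monoˡ-≤ ((u + w) * (P * cx)) (*-monoʳ-≤ (u + w) kk) ⟩
      (u + w) * (Q * s) + (u + w) * (P * cx)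
        ≡⟨ cong (_+ (u + w) * (P * cx)) (reorder (u + w) Q s) ⟩
      Q * ((u + w) * s) + (u + w) * (P * cx) ∎
      where
      left : ∀ j′ → j ≡ j′ → Q * sa + P * cx < Q * sx + P * ca
      left (suc j′) refl = supporting-left-< κ<β β≤a j′
      left zero     refl = ⊥-elim (n≮0 (subst (0 <_) w≡0 0<w))
        where
        w≡0 : w ≡ 0
        w≡0 = +-cancelˡ-≡ ca _ _ (trans (sym ew) (sym ep))

  -- The k-sets missing or meeting a fixed set.

  -- Recursion along both vectors lets `card-missing` follow Pascal's rule coordinate by coordinate.
  disjoint : Subset n → Subset n → Bool
  disjoint []      []      = true
  disjoint (x ∷ R) (y ∷ S) = not (x ∧ y) ∧ disjoint R S

  disjoint⁻ : (R S : Subset n) → T (disjoint R S) → ∀ v → lookup R v ≡ true → lookup S v ≡ false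
  disjoint⁻ (true ∷ R) (false ∷ S) t zero    e = refl
  disjoint⁻ (x ∷ R)    (y ∷ S)     t (suc v) e = disjoint⁻ R S (proj₂ (to (T-∧ {not (x ∧ y)}) t)) v e

  disjoint⁺ : (R S : Subset n) → (∀ v → lookup R v ≡ true → lookup S v ≡ false) → T (disjoint R S)
  disjoint⁺ [] [] d = tt
  disjoint⁺ (false ∷ R) (y ∷ S) d = disjoint⁺ R S (d ∘ suc)
  disjoint⁺ (true ∷ R) (y ∷ S) d with y | d zero refl
  ... | false | _ = disjoint⁺ R S (d ∘ suc)

  ¬disjoint⁻ : (R S : Subset n) → ¬ T (disjoint R S) → ∃ λ v → lookup R v ≡ true × lookup S v ≡ true
  ¬disjoint⁻ [] [] d = ⊥-elim (d tt)
  ¬disjoint⁻ (true ∷ R) (true ∷ S) d = zero , refl , refl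
  ¬disjoint⁻ (true ∷ R) (false ∷ S) d = let (v , e) = ¬disjoint⁻ R S d in suc v , e
  ¬disjoint⁻ (false ∷ R) (y ∷ S) d = let (v , e) = ¬disjoint⁻ R S d in suc v , e

  layer : ℕ → SetFamily n
  layer k S = ∣ S ∣ ≡ᵇ k

  missing : Subset n → ℕ → SetFamily n
  missing R k S = layer k S ∧ disjoint R S

  meeting : Subset n → ℕ → SetFamily n
  meeting R k S = layer k S ∧ not (disjoint R S)

  layer⁺ : ∀ {k} {S : Subset n} → ∣ S ∣ ≡ k → T (layer k S)
  layer⁺ = ≡⇒≡ᵇ _ _

  layer⁻ : ∀ {k} {S : Subset n} → T (layer k S) → ∣ S ∣ ≡ k
  layer⁻ = ≡ᵇ⇒≡ _ _

  card-∅ : (F : SetFamily n) → (∀ S → ¬ T (F S)) → card F ≡ 0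
  card-∅ {n} F e = trans (∑-cong (λ S → zero-at (F S) (e S))) (∑-zero n)
    where
    zero-at : ∀ x → ¬ T x → 𝟙 x ≡ 0
    zero-at false _ = refl
    zero-at true  e = ⊥-elim (e tt)

  card-missing : (R : Subset n) (k : ℕ) → card (missing R k) ≡ ∣ ∁ R ∣ C k
  card-missing [] zero    = refl
  card-missing [] (suc k) = sym (k>n⇒nCk≡0 {0} {suc k} (s≤s z≤n))
  card-missing (true ∷ R) k = cong₂ _+_
    (card-∅ (λ S → missing (true ∷ R) k (inside ∷ S)) (λ S t → proj₂ (to (T-∧ {suc ∣ S ∣ ≡ᵇ k}) t)))
    (card-missing R k)
  card-missing (false ∷ R) zero = trans (cong₂ _+_
    (card-∅ (λ S → missing (false ∷ R) zero (inside ∷ S)) (λ S t → t))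
    (card-missing R zero)) (trans (nC0≡1 ∣ ∁ R ∣) (sym (nC0≡1 (suc ∣ ∁ R ∣))))
  card-missing (false ∷ R) (suc k) = trans (cong₂ _+_ (card-missing R k) (card-missing R (suc k))) (sym (pascal ∣ ∁ R ∣ k))

  disjoint-∅ : (S : Subset n) → T (disjoint ∅ S)
  disjoint-∅ S = disjoint⁺ ∅ S λ v e → true≢false e (lookup-replicate v outside)

  card-layer : ∀ n k → card (layer {n} k) ≡ n C k
  card-layer n k = trans (card-cong {F = layer {n} k} {missing ∅ k}
      (λ {S} t → from T-∧ (t , disjoint-∅ S)) (λ {S} t → proj₁ (to (T-∧ {layer k S}) t)))
    (trans (card-missing (∅ {n}) k) (cong (_C k) (trans (∣∁p∣≡n∸∣p∣ (∅ {n})) (cong (n ∸_) (∣⊥∣≡0 n)))))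

  card-meeting : (R : Subset n) (k : ℕ) → card (meeting R k) + (∣ ∁ R ∣ C k) ≡ n C k
  card-meeting {n} R k = trans (cong (card (meeting R k) +_) (sym (card-missing R k)))
    (trans (≤-antisym
      (card-disjoint (meeting R k) (missing R k) (layer k)
        (λ {S} t → proj₁ (to (T-∧ {layer k S}) t)) (λ {S} t → proj₁ (to (T-∧ {layer k S}) t))
        (λ {S} t t′ → true≢false (to T-≡ (proj₂ (to (T-∧ {layer k S}) t′))) (to T-not-≡ (proj₂ (to (T-∧ {layer k S}) t)))))
      (card-cover (meeting R k) (missing R k) (layer k) (λ {S} → cover S)))
     (card-layer n k))
    where
    cover : ∀ S → T (layer k S) → T (meeting R k S) ⊎ T (missing R k S)
    cover S t with disjoint R S in eq
    ... | true  = inj₂ (from T-∧ (t , tt))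
    ... | false = inj₁ (from T-∧ (t , tt))

  -- From duplicate-free lists to indicator functions and complements.

  module _ {n : ℕ} where
    open DecMembership (≡-dec {n = n} _≟ᵇ_) public using (_∈?_)

  indicator : Family n → SetFamily n
  indicator 𝒜 S = ⌊ S ∈? Family.members 𝒜 ⌋

  indicator⁺ : (𝒜 : Family n) {S : Subset n} → ⟦ 𝒜 ⟧ S → T (indicator 𝒜 S)
  indicator⁺ 𝒜 = fromWitness

  indicator⁻ : (𝒜 : Family n) {S : Subset n} → T (indicator 𝒜 S) → ⟦ 𝒜 ⟧ S
  indicator⁻ 𝒜 = toWitness

  card-≡ : (x : Subset n) → card (λ S → ⌊ ≡-dec _≟ᵇ_ S x ⌋) ≡ 1
  card-≡ {n} x = go x (λ S → ⌊ ≡-dec _≟ᵇ_ S x ⌋) (λ t → toWitness t) (fromWitness refl)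
    where
    go : ∀ {n} (x : Subset n) (F : SetFamily n) → (∀ {S} → T (F S) → S ≡ x) → T (F x) → card F ≡ 1
    go [] F _ t with F []
    ... | true = refl
    go (true ∷ x) F s t = cong₂ _+_
      (go x (F ∘ (inside ∷_)) (λ t → cong tail (s t)) t)
      (card-∅ (F ∘ (outside ∷_)) (λ S t → true≢false refl (cong head (sym (s t)))))
    go (false ∷ x) F s t = cong₂ _+_
      (card-∅ (F ∘ (inside ∷_)) (λ S t → true≢false refl (cong head (s t))))
      (go x (F ∘ (outside ∷_)) (λ t → cong tail (s t)) t)

  -- Freedom from duplicates makes the head and the tail of the list disjoint as families, so length
  -- and size agree.
  card-indicator : (𝒜 : Family n) → card (indicator 𝒜) ≡ # 𝒜
  card-indicator {n} record { members = L ; unique = u } = go L u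
    where
    go : ∀ (L : List (Subset n)) → Unique L → card (λ S → ⌊ S ∈? L ⌋) ≡ length L
    go [] _ = card-∅ (λ (S : Subset n) → ⌊ S ∈? [] ⌋) (λ S ())
    go (x ∷ L) (x∉L ∷ u) = begin
      card (λ S → ⌊ S ∈? (x ∷ L) ⌋)
        ≡⟨ ≤-antisym
             (card-cover (λ S → ⌊ ≡-dec _≟ᵇ_ S x ⌋) (λ S → ⌊ S ∈? L ⌋) (λ S → ⌊ S ∈? (x ∷ L) ⌋) (λ t → split (toWitness t)))
             (card-disjoint (λ S → ⌊ ≡-dec _≟ᵇ_ S x ⌋) (λ S → ⌊ S ∈? L ⌋) (λ S → ⌊ S ∈? (x ∷ L) ⌋)
               (λ t → fromWitness (here (toWitness t))) (λ t → fromWitness (there (toWitness t)))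
               (λ {S} t t′ → All¬⇒¬Any x∉L (subst (List._∈ L) (toWitness {a? = ≡-dec _≟ᵇ_ S x} t) (toWitness t′)))) ⟩
      card (λ S → ⌊ ≡-dec _≟ᵇ_ S x ⌋) + card (λ S → ⌊ S ∈? L ⌋)
        ≡⟨ cong₂ _+_ (card-≡ x) (go L u) ⟩
      suc (length L) ∎
      where
      open ≡-Reasoning
      split : ∀ {S} → S List.∈ (x ∷ L) → T ⌊ ≡-dec _≟ᵇ_ S x ⌋ ⊎ T ⌊ S ∈? L ⌋
      split (here e)  = inj₁ (fromWitness e)
      split (there m) = inj₂ (fromWitness m)

  ∁-involutive : (S : Subset n) → ∁ (∁ S) ≡ S
  ∁-involutive []      = refl
  ∁-involutive (x ∷ S) = cong₂ _∷_ (not-involutive x) (∁-involutive S)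

  complements : Family n → SetFamily n
  complements ℬ = indicator ℬ ∘ ∁

  card-complements : (ℬ : Family n) → card (complements ℬ) ≡ # ℬ
  card-complements ℬ = trans (∑-∁ (𝟙 ∘ indicator ℬ)) (card-indicator ℬ)

  uniform-complements : ∀ {l} (ℬ : Family n) → ⟦ ℬ ⟧ ⊆ binom[ n ] l → Uniform (complements ℬ) (n ∸ l)
  uniform-complements {n} {l} ℬ u {S} t = begin
    ∣ S ∣           ≡⟨ cong ∣_∣ (∁-involutive S) ⟨
    ∣ ∁ (∁ S) ∣     ≡⟨ ∣∁p∣≡n∸∣p∣ (∁ S) ⟩
    n ∸ ∣ ∁ S ∣     ≡⟨ cong (n ∸_) (u (indicator⁻ ℬ t)) ⟩
    n ∸ l ∎
    where open ≡-Reasoning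

  shadowₙ⁻ : ∀ i (F : SetFamily n) {S} → T (shadowₙ i F S) →
    ∃ λ U → T (F U) × (∀ v → lookup S v ≡ true → lookup U v ≡ true)
  shadowₙ⁻ zero    F {S} t = S , t , λ v e → e
  shadowₙ⁻ (suc i) F {S} t with shadowₙ⁻ i (shadow F) {S} t
  ... | U , t′ , s with shadow⁻ F {U} t′
  ...   | w , t″ with link⁻ F {w} {U} t″
  ...     | _ , f = U [ w ]≔ inside , f , λ v e → keep v (s v e)
    where
    keep : ∀ v → lookup U v ≡ true → lookup (U [ w ]≔ inside) v ≡ true
    keep v e with v Fin.≟ w
    ... | yes refl = lookup∘update w U inside
    ... | no v≢w   = trans (lookup∘update′ v≢w U inside) e

  lookup-∁ : (S : Subset n) (v : Fin n) → lookup (∁ S) v ≡ not (lookup S v)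
  lookup-∁ S v = lookup-map v not S

  not-true : ∀ {x} → not x ≡ true → x ≡ false
  not-true {false} _ = refl

  not-false : ∀ {x} → not x ≡ false → x ≡ true
  not-false {true} _ = refl

  ∈⇒lookup : ∀ {v} {S : Subset n} → v ∈ S → lookup S v ≡ true
  ∈⇒lookup = []=⇒lookup

  lookup⇒∈ : ∀ {v} {S : Subset n} → lookup S v ≡ true → v ∈ S
  lookup⇒∈ {v = v} {S} = lookup⇒[]= v S

  -- Relabelling a set as an initial segment.

  -- Built one element at a time. A new first element in R takes position 0 and shifts the others;
  -- one outside R is inserted at position |R|, just behind the images of R, which stay where they
  -- are.
  perm-initial : (R : Subset n) → ∃ λ (σ : Permutation′ n) → ∀ v → lookup R v ≡ (toℕ (σ ⟨$⟩ʳ v) <ᵇ ∣ R ∣)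
  perm-initial [] = Perm.id , λ ()
  perm-initial (true ∷ R) with perm-initial R
  ... | σ , e = lift₀ σ , λ { zero → refl ; (suc v) → e v }
  perm-initial (false ∷ R) with perm-initial R
  ... | σ , e = insert zero j σ , λ { zero → sym (trans (cong (_<ᵇ ∣ R ∣) toℕ-j) (irrefl ∣ R ∣)) ; (suc v) → at-suc v }
    where
    j = fromℕ< (s≤s (∣p∣≤n R))
    toℕ-j : toℕ j ≡ ∣ R ∣
    toℕ-j = Fin.toℕ-fromℕ< (s≤s (∣p∣≤n R))
    irrefl : ∀ r → (r <ᵇ r) ≡ false
    irrefl zero    = refl
    irrefl (suc r) = irrefl r
    punchIn-< : ∀ {n} (j : Fin (suc n)) (i : Fin n) → (toℕ (punchIn j i) <ᵇ toℕ j) ≡ (toℕ i <ᵇ toℕ j)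
    punchIn-< zero    i       = refl
    punchIn-< (suc j) zero    = refl
    punchIn-< (suc j) (suc i) = punchIn-< j i
    at-suc : ∀ v → lookup R v ≡ (toℕ (insert zero j σ ⟨$⟩ʳ suc v) <ᵇ ∣ R ∣)
    at-suc v = begin
      lookup R v                                     ≡⟨ e v ⟩
      (toℕ (σ ⟨$⟩ʳ v) <ᵇ ∣ R ∣)                      ≡⟨ cong (toℕ (σ ⟨$⟩ʳ v) <ᵇ_) toℕ-j ⟨
      (toℕ (σ ⟨$⟩ʳ v) <ᵇ toℕ j)                      ≡⟨ punchIn-< j (σ ⟨$⟩ʳ v) ⟨
      (toℕ (punchIn j (σ ⟨$⟩ʳ v)) <ᵇ toℕ j)          ≡⟨ cong₂ (λ a b → toℕ a <ᵇ b) (sym (insert-punchIn zero j σ v)) toℕ-j ⟩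
      (toℕ (insert zero j σ ⟨$⟩ʳ suc v) <ᵇ ∣ R ∣)    ∎
      where open ≡-Reasoning

  ∣image∣ : (σ : Permutation′ n) (S : Subset n) → ∣ image σ S ∣ ≡ ∣ S ∣
  ∣image∣ {n} σ S = begin
    ∣ image σ S ∣                                   ≡⟨ sum-lookup (image σ S) ⟨
    sum (λ v → 𝟙 (lookup (image σ S) v))
      ≡⟨ sum-cong-≗ {n} (λ v → cong 𝟙 (lookup∘tabulate (λ i → lookup S (σ ⟨$⟩ˡ i)) v)) ⟩
    sum (λ v → 𝟙 (lookup S (σ ⟨$⟩ˡ v)))             ≡⟨ sum-permute (λ v → 𝟙 (lookup S v)) (Perm.flip σ) ⟨
    sum (λ v → 𝟙 (lookup S v))                      ≡⟨ sum-lookup S ⟩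
    ∣ S ∣ ∎
    where open ≡-Reasoning

  ∣[]∣ : ∀ {n r} → r ≤ n → ∣ [_] {n} r ∣ ≡ r
  ∣[]∣ {zero}  {zero}  _ = refl
  ∣[]∣ {suc n} {zero}  _ = ∣[]∣ {n} {zero} z≤n
  ∣[]∣ {suc n} {suc r} (s≤s r≤n) = cong suc (∣[]∣ {n} {r} r≤n)

  module _ {n : ℕ} (σ : Permutation′ n) (r : ℕ) (R : Subset n)
           (aligned : ∀ v → lookup R v ≡ lookup [ r ] (σ ⟨$⟩ʳ v)) where

    private
      lookup-image : ∀ S v → lookup (image σ S) (σ ⟨$⟩ʳ v) ≡ lookup S v
      lookup-image S v = trans (lookup∘tabulate _ (σ ⟨$⟩ʳ v)) (cong (lookup S) (Perm.inverseˡ σ))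

    meets-image : ∀ {S} → (¬ T (disjoint R S)) ⇔ Nonempty ([ r ] ∩ image σ S)
    meets-image {S} = mk⇔
      (λ d → let (v , e , f) = ¬disjoint⁻ R S d in
        σ ⟨$⟩ʳ v , x∈p∩q⁺ (lookup⇒∈ (trans (sym (aligned v)) e) , lookup⇒∈ (trans (lookup-image S v) f)))
      (λ { (i , m) d → let (m₁ , m₂) = x∈p∩q⁻ [ r ] (image σ S) m
                           v = σ ⟨$⟩ˡ i
                           e : lookup R v ≡ true
                           e = trans (aligned v) (trans (cong (lookup [ r ]) (Perm.inverseʳ σ)) (∈⇒lookup m₁))
                           f : lookup S v ≡ true
                           f = trans (sym (lookup∘tabulate _ i)) (∈⇒lookup m₂)
                       in true≢false f (disjoint⁻ R S d v e) })

    contained-image : ∀ {S} → T (disjoint R (∁ S)) ⇔ [ r ] ⊆ₛ image σ S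
    contained-image {S} = mk⇔
      (λ d {i} m → let v = σ ⟨$⟩ˡ i
                       e : lookup R v ≡ true
                       e = trans (aligned v) (trans (cong (lookup [ r ]) (Perm.inverseʳ σ)) (∈⇒lookup m))
                   in lookup⇒∈ (trans (lookup∘tabulate _ i) (not-false (trans (sym (lookup-∁ S v)) (disjoint⁻ R (∁ S) d v e)))))
      (λ s → disjoint⁺ R (∁ S) (λ v e → trans (lookup-∁ S v) (cong not
        (trans (sym (lookup-image S v)) (∈⇒lookup (s (lookup⇒∈ (trans (sym (aligned v)) e))))))))

  -- The pairs of (i) up to relabelling: R is the preimage of [r], and R ⊆ S is
  -- expressed as R ∩ ∁ S = ∅.
  Star : ∀ {n} (k l r : ℕ) (𝒜 ℬ : Family n) → Set
  Star {n} k l r 𝒜 ℬ = ∃ λ (R : Subset n) → ∣ R ∣ ≡ r ×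
    ⟦ 𝒜 ⟧ ≐ (λ S → ∣ S ∣ ≡ k × ¬ T (disjoint R S)) ×
    ⟦ ℬ ⟧ ≐ (λ S → ∣ S ∣ ≡ l × T (disjoint R (∁ S)))

  module _ {n k l r : ℕ} (r≤n : r ≤ n) (𝒜 ℬ : Family n) where

    star⇒relabelling : Star k l r 𝒜 ℬ → EqualUpToRelabelling 𝒜 ℬ
      (λ A → binom[ n ] k A × Nonempty ([ r ] ∩ A)) (λ B → binom[ n ] l B × [ r ] ⊆ₛ B)
    star⇒relabelling (R , refl , (a , a′) , (b , b′)) with perm-initial R
    ... | σ , e = σ ,
      ((λ {S} m → let (s , d) = a m in trans (∣image∣ σ S) s , to (meets-image σ r R al) d) ,
       (λ {S} (s , d) → a′ (trans (sym (∣image∣ σ S)) s , from (meets-image σ r R al) d))) ,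
      ((λ {S} m → let (s , d) = b m in trans (∣image∣ σ S) s , to (contained-image σ r R al {S}) d) ,
       (λ {S} (s , d) → b′ (trans (sym (∣image∣ σ S)) s , from (contained-image σ r R al {S}) d)))
      where
      al : ∀ v → lookup R v ≡ lookup [ r ] (σ ⟨$⟩ʳ v)
      al v = trans (e v) (sym (lookup∘tabulate _ (σ ⟨$⟩ʳ v)))

    relabelling⇒star : EqualUpToRelabelling 𝒜 ℬ
      (λ A → binom[ n ] k A × Nonempty ([ r ] ∩ A)) (λ B → binom[ n ] l B × [ r ] ⊆ₛ B) → Star k l r 𝒜 ℬ
    relabelling⇒star (σ , (a , a′) , (b , b′)) = R , trans (∣image∣ (Perm.flip σ) [ r ]) (∣[]∣ r≤n) ,
      ((λ {S} m → let (s , d) = a m in trans (sym (∣image∣ σ S)) s , from (meets-image σ r R al) d) ,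
       (λ {S} (s , d) → a′ (trans (∣image∣ σ S) s , to (meets-image σ r R al) d))) ,
      ((λ {S} m → let (s , d) = b m in trans (sym (∣image∣ σ S)) s , from (contained-image σ r R al {S}) d) ,
       (λ {S} (s , d) → b′ (trans (∣image∣ σ S) s , to (contained-image σ r R al {S}) d)))
      where
      R : Subset n
      R = image (Perm.flip σ) [ r ]
      al : ∀ v → lookup R v ≡ lookup [ r ] (σ ⟨$⟩ʳ v)
      al v = lookup∘tabulate _ v

  -- Cross-intersecting pairs through the shadow of the complements.

  module CrossIntersectingPair {n k l : ℕ} (k+l≤n : k + l ≤ n) (𝒜 ℬ : Family n)
    (𝒜-uniform : ⟦ 𝒜 ⟧ ⊆ binom[ n ] k) (ℬ-uniform : ⟦ ℬ ⟧ ⊆ binom[ n ] l) (cross : CrossIntersecting 𝒜 ℬ) where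

    private
      A F : SetFamily n
      A = indicator 𝒜
      F = complements ℬ

      l≤n : l ≤ n
      l≤n = ≤-trans (m≤n+m l k) k+l≤n

      A⊑layer : A ⊑ layer k
      A⊑layer {S} t = layer⁺ {S = S} (𝒜-uniform (indicator⁻ 𝒜 t))

    -- A set in an iterated shadow lies inside some U with ∁ U ∈ ℬ, and so is disjoint from that
    -- member of ℬ.
    avoids-shadow : ∀ i {S} → T (A S) → ¬ T (shadowₙ i F S)
    avoids-shadow i {S} t t′ with shadowₙ⁻ i F {S} t′
    ... | U , f , s with cross (indicator⁻ 𝒜 {S} t) (indicator⁻ ℬ {∁ U} f)
    ...   | v , m = let (m₁ , m₂) = x∈p∩q⁻ S (∁ U) m in
      true≢false (s v (∈⇒lookup m₁)) (not-true (trans (sym (lookup-∁ U v)) (∈⇒lookup m₂)))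

    uniform-F : ∀ {b} → n ∸ l ≡ b → Uniform F b
    uniform-F e {S} t = trans (uniform-complements ℬ ℬ-uniform {S} t) e

    card-bound : ∀ i → n ∸ l ≡ i + k → # 𝒜 + card (shadowₙ i F) ≤ n C k
    card-bound i e = subst₂ _≤_ (cong (_+ card (shadowₙ i F)) (card-indicator 𝒜)) (card-layer n k)
      (card-disjoint A (shadowₙ i F) (layer k) A⊑layer
        (λ {S} t → layer⁺ {S = S} (uniform-shadowₙ i F (uniform-F e) {S} t)) (avoids-shadow i))

    module _ (e : n ∸ l ≡ k) where

      private
        co⁺ : ∀ {S} → T (F S) → co ℬ S
        co⁺ {S} t = ∁ S , indicator⁻ ℬ t , sym (∁-involutive S)

        co⁻ : ∀ {S} → co ℬ S → T (F S)
        co⁻ (B , m , refl) = indicator⁺ ℬ (subst ⟦ ℬ ⟧ (sym (∁-involutive B)) m)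

        A∁ : SetFamily n
        A∁ S = layer k S ∧ not (F S)

        A⊑A∁ : A ⊑ A∁
        A⊑A∁ {S} t = from T-∧ (A⊑layer {S} t , ¬T⇒T-not (avoids-shadow 0 {S} t))

        card-A∁ : card A∁ + # ℬ ≤ n C k
        card-A∁ = subst₂ _≤_ (cong (card A∁ +_) (card-complements ℬ)) (card-layer n k)
          (card-disjoint A∁ F (layer k) (λ {S} t → proj₁ (to (T-∧ {layer k S}) t))
            (λ {S} t → layer⁺ {S = S} (uniform-F e {S} t))
            (λ {S} t t′ → true≢false (to T-≡ t′) (to T-not-≡ (proj₂ (to (T-∧ {layer k S}) t)))))

      -- With no deletion to make, 𝒜 and the complements of ℬ are disjoint within the k-sets, and 𝒜
      -- consists of all the others exactly when the sizes add up to C(n,k).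
      complementary⇔ : ⟦ 𝒜 ⟧ ≐ (λ S → binom[ n ] k S × ¬ co ℬ S) ⇔ (# 𝒜 + # ℬ ≡ n C k)
      complementary⇔ = mk⇔ count conclude
        where
        count : ⟦ 𝒜 ⟧ ≐ (λ S → binom[ n ] k S × ¬ co ℬ S) → # 𝒜 + # ℬ ≡ n C k
        count (_ , s) = ≤-antisym
          (subst (λ m → # 𝒜 + m ≤ n C k) (card-complements ℬ) (card-bound 0 e))
          (subst₂ _≤_ (card-layer n k) (cong₂ _+_ (card-indicator 𝒜) (card-complements ℬ))
            (card-cover A F (layer k) (λ {S} → cover S)))
          where
          cover : ∀ S → T (layer k S) → T (A S) ⊎ T (F S)
          cover S t with T? (F S)
          ... | yes f = inj₂ f
          ... | no ¬f = inj₁ (indicator⁺ 𝒜 (s (layer⁻ {S = S} t , λ c → ¬f (co⁻ c))))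
        conclude : # 𝒜 + # ℬ ≡ n C k → ⟦ 𝒜 ⟧ ≐ (λ S → binom[ n ] k S × ¬ co ℬ S)
        conclude eq = (λ {S} m → 𝒜-uniform m , λ c → avoids-shadow 0 {S} (indicator⁺ 𝒜 m) (co⁻ c)) ,
          (λ {S} (s , c) → indicator⁻ 𝒜 (A∁⊑A {S} (from T-∧ (layer⁺ {S = S} s , ¬T⇒T-not (c ∘ co⁺)))))
          where
          A∁⊑A : A∁ ⊑ A
          A∁⊑A = card-⊑-≡ {F = A} {A∁} (λ {S} → A⊑A∁ {S}) (+-cancelʳ-≤ (# ℬ) _ _
            (≤-trans card-A∁ (≤-reflexive (trans (sym eq) (cong (_+ # ℬ) (sym (card-indicator 𝒜)))))))

    module _ {j κ : ℕ} (k≡ : k ≡ suc κ) (e : n ∸ l ≡ suc j + suc κ) where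

      private
        b : ℕ
        b = suc j + suc κ

        uF : Uniform F b
        uF = uniform-F e

        s : ℕ
        s = card (shadowₙ (suc j) F)

        b≤ : ∀ {r} → r ≤ l → b ≤ n ∸ r
        b≤ {r} r≤l = subst (_≤ n ∸ r) e (∸-monoʳ-≤ n r≤l)

        bound : # 𝒜 + s ≤ n C suc κ
        bound = subst (λ k → # 𝒜 + s ≤ n C k) k≡ (card-bound (suc j) (trans e (cong (suc j +_) (sym k≡))))

        card-F : ∀ {x} → # ℬ ≡ x → card F ≡ x
        card-F = trans (card-complements ℬ)

      endpoint-bound : ∀ {r} → r ≤ l → # ℬ ≡ (n ∸ r) C b → # 𝒜 + ((n ∸ r) C suc κ) ≤ n C suc κ
      endpoint-bound {r} r≤l eB = ≤-trans
        (+-monoʳ-≤ (# 𝒜) (kruskal-katonaₙ-C (suc j) F {n ∸ r} uF (b≤ r≤l) (≤-reflexive (sym (card-F eB))))) bound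

      -- Equality makes the shadow as small as possible, so the complements of ℬ live on an x-set X
      -- and, by counting, are all its b-subsets. Its complement R is the common core of ℬ, and 𝒜
      -- must be all k-sets that meet R.
      endpoint-star : ∀ {r} → r ≤ l → # ℬ ≡ (n ∸ r) C b → # 𝒜 + ((n ∸ r) C suc κ) ≡ n C suc κ → Star (suc κ) l r 𝒜 ℬ
      endpoint-star {r} r≤l eB eA = conclude (support-sizeₙ j F {x} uF (b≤ r≤l) (card-F eB) s≤)
        where
        x : ℕ
        x = n ∸ r
        s≤ : s ≤ x C suc κ
        s≤ = +-cancelˡ-≤ (# 𝒜) _ _ (≤-trans bound (≤-reflexive (sym eA)))
        s≥ : x C suc κ ≤ s
        s≥ = kruskal-katonaₙ-C (suc j) F uF (b≤ r≤l) (≤-reflexive (sym (card-F eB)))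
        conclude : (∃ λ X → ∣ X ∣ ≤ x × (∀ {S} → T (F S) → ∀ w → lookup S w ≡ true → lookup X w ≡ true)) → Star (suc κ) l r 𝒜 ℬ
        conclude (X , X≤x , covers) = R , ∣R∣ , (𝒜⊆ , ⊆𝒜) , (ℬ⊆ , ⊆ℬ)
          where
          R : Subset n
          R = ∁ X
          inside-X⇒disjoint : ∀ {S} → (∀ w → lookup S w ≡ true → lookup X w ≡ true) → T (disjoint R S)
          inside-X⇒disjoint {S} c = disjoint⁺ R S λ v e → outside-S v (not-true (trans (sym (lookup-∁ X v)) e))
            where
            outside-S : ∀ v → lookup X v ≡ false → lookup S v ≡ false
            outside-S v f with lookup S v in eq
            ... | true  = true≢false (c v eq) f
            ... | false = refl
          F⊑ : F ⊑ missing R b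
          F⊑ {S} t = from T-∧ (layer⁺ {S = S} (uF {S} t) , inside-X⇒disjoint (covers {S} t))
          card-missing-R : ∀ k → card (missing R k) ≡ ∣ X ∣ C k
          card-missing-R k = trans (card-missing R k) (cong (λ S → ∣ S ∣ C k) (∁-involutive X))
          ∣X∣ : ∣ X ∣ ≡ x
          -- A smaller X would have too few b-subsets to hold F; the comparison is strict because b
          -- ≤ x.
          ∣X∣ = ≤-antisym X≤x (≮⇒≥ λ X<x → <-irrefl refl (begin-strict
            x C b                 ≡⟨ card-F eB ⟨
            card F                ≤⟨ card-mono {F = F} {missing R b} (λ {S} → F⊑ {S}) ⟩
            card (missing R b)    ≡⟨ card-missing-R b ⟩
            ∣ X ∣ C b             ≤⟨ C-mono-≤ b (s≤s⁻¹ (<-≤-trans X<x (≤-reflexive (sym suc-pred-x)))) ⟩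
            ℕ.pred x C b
              <⟨ C-mono-< (j + suc κ) (s≤s⁻¹ (≤-trans (b≤ r≤l) (≤-reflexive (sym suc-pred-x)))) (≤-reflexive suc-pred-x) ⟩
            x C b                 ∎))
            where
            open ≤-Reasoning
            suc-pred-x : suc (ℕ.pred x) ≡ x
            suc-pred-x = suc-pred x {{>-nonZero (≤-trans (s≤s z≤n) (b≤ r≤l))}}
          ∣R∣ : ∣ R ∣ ≡ r
          ∣R∣ = trans (∣∁p∣≡n∸∣p∣ X) (trans (cong (n ∸_) ∣X∣) (m∸[m∸n]≡n (≤-trans r≤l l≤n)))
          ⊑F : missing R b ⊑ F
          ⊑F = card-⊑-≡ {F = F} {missing R b} (λ {S} → F⊑ {S})
            (≤-reflexive (trans (card-missing-R b) (trans (cong (_C b) ∣X∣) (sym (card-F eB)))))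
          ∂ : SetFamily n
          ∂ = shadowₙ (suc j) F
          ∂⊑ : ∂ ⊑ missing R (suc κ)
          ∂⊑ {S} t with shadowₙ⁻ (suc j) F {S} t
          ... | U , f , c = from T-∧ (layer⁺ {S = S} (uniform-shadowₙ (suc j) F uF {S} t) ,
            inside-X⇒disjoint (λ w e → covers f w (c w e)))
          -- The shadow lies inside X and has at least C(x,k) members, so it contains every k-subset
          -- of X. Avoiding the shadow then means meeting R.
          ⊑∂ : missing R (suc κ) ⊑ ∂
          ⊑∂ = card-⊑-≡ {F = ∂} {missing R (suc κ)} (λ {S} → ∂⊑ {S})
            (≤-trans (≤-reflexive (trans (card-missing-R (suc κ)) (cong (_C suc κ) ∣X∣))) s≥)
          A⊑ : A ⊑ meeting R (suc κ)
          A⊑ {S} t = from T-∧ (t′ , meets (disjoint R S) refl)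
            where
            t′ : T (layer (suc κ) S)
            t′ = layer⁺ {S = S} (trans (𝒜-uniform (indicator⁻ 𝒜 t)) k≡)
            meets : ∀ y → disjoint R S ≡ y → T (not y)
            meets false _ = tt
            meets true  d = avoids-shadow (suc j) {S} t (⊑∂ {S} (from T-∧ (t′ , from T-≡ d)))
          ⊑A : meeting R (suc κ) ⊑ A
          ⊑A = card-⊑-≡ {F = A} {meeting R (suc κ)} (λ {S} → A⊑ {S}) (+-cancelʳ-≤ (x C suc κ) _ _ (≤-reflexive (begin
            card (meeting R (suc κ)) + (x C suc κ)
              ≡⟨ cong (λ y → card (meeting R (suc κ)) + (y C suc κ)) (trans (cong ∣_∣ (∁-involutive X)) ∣X∣) ⟨
            card (meeting R (suc κ)) + (∣ ∁ R ∣ C suc κ)   ≡⟨ card-meeting R (suc κ) ⟩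
            n C suc κ                                      ≡⟨ eA ⟨
            # 𝒜 + (x C suc κ)                              ≡⟨ cong (_+ (x C suc κ)) (card-indicator 𝒜) ⟨
            card A + (x C suc κ) ∎)))
            where open ≡-Reasoning
          𝒜⊆ : ⟦ 𝒜 ⟧ ⊆ (λ S → ∣ S ∣ ≡ suc κ × ¬ T (disjoint R S))
          𝒜⊆ {S} m = trans (𝒜-uniform m) k≡ , λ t → true≢false (to T-≡ t) (to T-not-≡ (proj₂ (to (T-∧ {layer (suc κ) S}) (A⊑ {S} (indicator⁺ 𝒜 m)))))
          ⊆𝒜 : (λ S → ∣ S ∣ ≡ suc κ × ¬ T (disjoint R S)) ⊆ ⟦ 𝒜 ⟧
          ⊆𝒜 {S} (s , d) = indicator⁻ 𝒜 (⊑A {S} (from T-∧ (layer⁺ {S = S} s , ¬T⇒T-not d)))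
          ℬ⊆ : ⟦ ℬ ⟧ ⊆ (λ S → ∣ S ∣ ≡ l × T (disjoint R (∁ S)))
          ℬ⊆ {S} m = ℬ-uniform m , proj₂ (to (T-∧ {layer b (∁ S)}) (F⊑ {∁ S} (indicator⁺ ℬ (subst ⟦ ℬ ⟧ (sym (∁-involutive S)) m))))
          ⊆ℬ : (λ S → ∣ S ∣ ≡ l × T (disjoint R (∁ S))) ⊆ ⟦ ℬ ⟧
          ⊆ℬ {S} (s , d) = subst ⟦ ℬ ⟧ (∁-involutive S) (indicator⁻ ℬ (⊑F {∁ S}
            (from T-∧ (layer⁺ {S = ∁ S} (trans (∣∁p∣≡n∸∣p∣ S) (trans (cong (n ∸_) s) e)) , d))))

      -- Subtraction from C(n,k) turns a shadow strictly above its chord into |𝒜| strictly below the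
      -- chord between the end sizes α₀ and α₁.
      interior-bound : ∀ {r r′ u w α₀ α₁} → r ≤ l → r′ ≤ r →
        # ℬ ≡ ((n ∸ r) C b) + w → (n ∸ r′) C b ≡ # ℬ + u → 0 < u → 0 < w →
        α₀ + ((n ∸ r) C suc κ) ≡ n C suc κ → α₁ + ((n ∸ r′) C suc κ) ≡ n C suc κ →
        (u + w) * # 𝒜 < u * α₀ + w * α₁
      interior-bound {r} {r′} {u} {w} {α₀} {α₁} r≤l r′≤r ew eu 0<u 0<w e₀ e₁ = +-cancelʳ-< ((u + w) * s) _ _ (begin-strict
        (u + w) * # 𝒜 + (u + w) * s                ≡⟨ *-distribˡ-+ (u + w) (# 𝒜) s ⟨
        (u + w) * (# 𝒜 + s)                        ≤⟨ *-monoʳ-≤ (u + w) bound ⟩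
        (u + w) * (n C suc κ)                      ≡⟨ *-distribʳ-+ (n C suc κ) u w ⟩
        u * (n C suc κ) + w * (n C suc κ)          ≡⟨ cong₂ (λ p q → u * p + w * q) e₀ e₁ ⟨
        u * (α₀ + S₀) + w * (α₁ + S₁)              ≡⟨ regroup u w α₀ α₁ S₀ S₁ ⟩
        u * α₀ + w * α₁ + (u * S₀ + w * S₁)
          <⟨ +-monoʳ-< (u * α₀ + w * α₁) (above-chord j F uF (b≤ r≤l) (∸-monoʳ-≤ n r′≤r)
                                                        (card-F ew) (trans eu (cong (_+ u) (sym (card-complements ℬ)))) 0<u 0<w) ⟩
        u * α₀ + w * α₁ + (u + w) * s              ∎)
        where
        open ≤-Reasoning
        S₀ = (n ∸ r) C suc κ
        S₁ = (n ∸ r′) C suc κ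
        regroup : ∀ u w a b c d → u * (a + c) + w * (b + d) ≡ u * a + w * b + (u * c + w * d)
        regroup = solve-∀

  -- Sizes of the extremal pairs, and the case r = 1.

  -- The symmetric form has the lower index n - l for every r, so both ends of the range of |ℬ|
  -- become points of one curve, indexed by the size of the complements.
  C-complement : ∀ {n l r} → l ≤ n → r ≤ l → (n ∸ r) C (l ∸ r) ≡ (n ∸ r) C (n ∸ l)
  C-complement {n} {l} {r} l≤n r≤l = trans (nCk≡nC[n∸k] (∸-monoˡ-≤ r l≤n))
    (cong ((n ∸ r) C_) (trans (∸-+-assoc n r (l ∸ r)) (cong (n ∸_) (m+[n∸m]≡n r≤l))))

  star-sizes : ∀ {k l r} → r ≤ l → l ≤ n → (𝒜 ℬ : Family n) → Star k l r 𝒜 ℬ →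
    # 𝒜 + ((n ∸ r) C k) ≡ n C k × # ℬ ≡ (n ∸ r) C (l ∸ r)
  star-sizes {n} {k} {l} {r} r≤l l≤n 𝒜 ℬ (R , refl , (a , a′) , (b , b′)) = sizeA , sizeB
    where
    cA : card (indicator 𝒜) ≡ card (meeting R k)
    cA = card-cong {F = indicator 𝒜} {meeting R k}
      (λ {S} t → let (s , d) = a (indicator⁻ 𝒜 t) in from T-∧ (layer⁺ {S = S} s , ¬T⇒T-not d))
      (λ {S} t → let (s , d) = to (T-∧ {layer k S}) t in
         indicator⁺ 𝒜 (a′ (layer⁻ {S = S} s , λ d′ → true≢false (to T-≡ d′) (to T-not-≡ d))))
    sizeA : # 𝒜 + ((n ∸ r) C k) ≡ n C k
    sizeA = trans (cong₂ _+_ (trans (sym (card-indicator 𝒜)) cA) (cong (_C k) (sym (∣∁p∣≡n∸∣p∣ R)))) (card-meeting R k)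
    cB : card (complements ℬ) ≡ card (missing R (n ∸ l))
    cB = card-cong {F = complements ℬ} {missing R (n ∸ l)}
      (λ {S} t → let (s , d) = b (indicator⁻ ℬ t) in from T-∧
         (layer⁺ {S = S} (uniform-complements ℬ (λ m → proj₁ (b m)) {S} t) , subst (T ∘ disjoint R) (∁-involutive S) d))
      (λ {S} t → let (s , d) = to (T-∧ {layer (n ∸ l) S}) t in
         indicator⁺ ℬ (b′ (trans (∣∁p∣≡n∸∣p∣ S) (trans (cong (n ∸_) (layer⁻ {S = S} s)) (m∸[m∸n]≡n l≤n)) ,
                           subst (T ∘ disjoint R) (sym (∁-involutive S)) d)))
    sizeB : # ℬ ≡ (n ∸ r) C (l ∸ r)
    sizeB = trans (sym (card-complements ℬ)) (trans cB (trans (card-missing R (n ∸ l))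
      (trans (cong (_C (n ∸ l)) (∣∁p∣≡n∸∣p∣ R)) (sym (C-complement l≤n r≤l)))))

  contains1⇔meets : ∀ {n} {S : Subset n} → Contains1 S ⇔ Nonempty ([ 1 ] ∩ S)
  contains1⇔meets {n} {S} = mk⇔
    (λ (i , z , m) → i , x∈p∩q⁺ (lookup⇒∈ (trans (lookup∘tabulate _ i) (cong (_<ᵇ 1) z)) , m))
    (λ (i , m) → let (m₁ , m₂) = x∈p∩q⁻ [ 1 ] S m in i , index-zero i (∈⇒lookup m₁) , m₂)
    where
    index-zero : ∀ (i : Fin n) → lookup [ 1 ] i ≡ true → toℕ i ≡ 0
    index-zero i e = below-one (toℕ i) (trans (sym (lookup∘tabulate _ i)) e)
      where
      below-one : ∀ m → (m <ᵇ 1) ≡ true → m ≡ 0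
      below-one zero _ = refl
      below-one (suc m) ()

  contains1⇔contains : ∀ {n} {S : Subset (suc n)} → Contains1 S ⇔ [ 1 ] ⊆ₛ S
  contains1⇔contains {n} {S} = mk⇔
    (λ { (zero , z , m) {i} e → subst (_∈ S) (sym (index-zero i (∈⇒lookup e))) m })
    (λ s → zero , refl , s (lookup⇒∈ {v = zero} refl))
    where
    index-zero : ∀ (i : Fin (suc n)) → lookup [ 1 ] i ≡ true → i ≡ zero
    index-zero zero    _ = refl
    index-zero (suc i) e = true≢false e (lookup∘tabulate _ i)

  -- Since [1] is a singleton, meeting it and containing it both mean 1 ∈ S. The structure in (ii)
  -- is that of (i) at r = 1.
  relabelling₁ : ∀ {n} (k l : ℕ) (𝒜 ℬ : Family (suc n)) →
    EqualUpToRelabelling 𝒜 ℬ (λ A → binom[ suc n ] k A × Contains1 A)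
    (λ B → binom[ suc n ] l B × Contains1 B) ⇔
    EqualUpToRelabelling 𝒜 ℬ (λ A → binom[ suc n ] k A × Nonempty ([ 1 ] ∩ A))
    (λ B → binom[ suc n ] l B × [ 1 ] ⊆ₛ B)
  relabelling₁ k l 𝒜 ℬ = mk⇔
    (λ (σ , (a , a′) , (b , b′)) → σ ,
      ((λ m → let (s , c) = a m in s , to contains1⇔meets c) , (λ (s , c) → a′ (s , from contains1⇔meets c))) ,
      ((λ {S} m → let (s , c) = b m in s , to (contains1⇔contains {S = image σ S}) c) ,
       (λ {S} (s , c) → b′ (s , from (contains1⇔contains {S = image σ S}) c))))
    (λ (σ , (a , a′) , (b , b′)) → σ ,
      ((λ m → let (s , c) = a m in s , from contains1⇔meets c) , (λ (s , c) → a′ (s , to contains1⇔meets c))) ,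
      ((λ {S} m → let (s , c) = b m in s , from (contains1⇔contains {S = image σ S}) c) ,
       (λ {S} (s , c) → b′ (s , to (contains1⇔contains {S = image σ S}) c))))

-- Order and cancellation in an ordered field.

module OrderedFieldProperties {a ℓ₁ ℓ₂} (𝔽 : OrderedField a ℓ₁ ℓ₂) where
  open OrderedField 𝔽 renaming (refl to ≈-refl; sym to ≈-sym; trans to ≈-trans) public
  open DecTotalOrder decTotalOrder public using (poset; totalOrder; total; _≟_; antisym)
    renaming (refl to ≤-refl; reflexive to ≤-reflexive; trans to ≤-trans; ≤-respˡ-≈ to ≤-respˡ; ≤-respʳ-≈ to ≤-respʳ)
  open Mult semiring using (×-homo-+; ×1-homo-*)
  open PosetReasoning poset
  open SemiringSolver commutativeSemiring using (solve; _:+_; _:*_; _:=_)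

  <⇒≤ : ∀ {x y} → x < y → x ≤ y
  <⇒≤ = proj₁

  <⇒≱ : ∀ {x y} → x < y → ¬ (y ≤ x)
  <⇒≱ (x≤y , x≉y) y≤x = x≉y (antisym x≤y y≤x)

  +-monoʳ-≤ : ∀ z {x y} → x ≤ y → z + x ≤ z + y
  +-monoʳ-≤ z {x} {y} x≤y = begin
    z + x ≈⟨ +-comm z x ⟩
    x + z ≤⟨ +-monoˡ-≤ z x≤y ⟩
    y + z ≈⟨ +-comm y z ⟩
    z + y ∎

  +-mono-≤ : ∀ {x y u v} → x ≤ y → u ≤ v → x + u ≤ y + v
  +-mono-≤ x≤y u≤v = ≤-trans (+-monoˡ-≤ _ x≤y) (+-monoʳ-≤ _ u≤v)

  [x+y]-y≈x : ∀ x y → (x + y) - y ≈ x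
  [x+y]-y≈x x y = ≈-trans (+-assoc x y (- y)) (≈-trans (+-congˡ (-‿inverseʳ y)) (+-identityʳ x))

  +-cancelʳ : ∀ z {x y} → x + z ≈ y + z → x ≈ y
  +-cancelʳ z {x} {y} e = ≈-trans (≈-sym ([x+y]-y≈x x z)) (≈-trans (+-congʳ e) ([x+y]-y≈x y z))

  +-monoˡ-< : ∀ z {x y} → x < y → x + z < y + z
  +-monoˡ-< z (x≤y , x≉y) = +-monoˡ-≤ z x≤y , x≉y ∘ +-cancelʳ z

  +-monoʳ-< : ∀ z {x y} → x < y → z + x < z + y
  +-monoʳ-< z {x} {y} x<y = begin-strict
    z + x ≈⟨ +-comm z x ⟩
    x + z <⟨ +-monoˡ-< z x<y ⟩
    y + z ≈⟨ +-comm y z ⟩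
    z + y ∎

  x≤x+y : ∀ x {y} → 0# ≤ y → x ≤ x + y
  x≤x+y x 0≤y = ≤-respˡ (+-identityʳ x) (+-monoʳ-≤ x 0≤y)

  difference : ∀ {x y} → x ≤ y → ∃ λ d → 0# ≤ d × y ≈ x + d
  difference {x} {y} x≤y = y - x ,
    (begin 0# ≈⟨ -‿inverseʳ x ⟨ x - x ≤⟨ +-monoˡ-≤ (- x) x≤y ⟩ y - x ∎) ,
    ≈-sym (≈-trans (+-comm x (y - x)) (≈-trans (+-assoc y (- x) x) (≈-trans (+-congˡ (-‿inverseˡ x)) (+-identityʳ y))))

  *-monoʳ-≤ : ∀ {z x y} → 0# ≤ z → x ≤ y → z * x ≤ z * y
  *-monoʳ-≤ {z} {x} {y} 0≤z x≤y with difference x≤y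
  ... | d , 0≤d , y≈x+d = begin
    z * x           ≤⟨ x≤x+y (z * x) (*-nonneg 0≤z 0≤d) ⟩
    z * x + z * d   ≈⟨ distribˡ z x d ⟨
    z * (x + d)     ≈⟨ *-congˡ y≈x+d ⟨
    z * y           ∎

  *-cancelˡ : ∀ {z x y} → 0# < z → z * x ≈ z * y → x ≈ y
  *-cancelˡ {z} {x} {y} (_ , 0≉z) e with inverse z (0≉z ∘ ≈-sym)
  ... | z⁻¹ , zz⁻¹≈1 = ≈-trans (≈-sym (undo x)) (≈-trans (*-congˡ e) (undo y))
    where
    undo : ∀ x → z⁻¹ * (z * x) ≈ x
    undo x = ≈-trans (≈-sym (*-assoc z⁻¹ z x)) (≈-trans (*-congʳ (≈-trans (*-comm z⁻¹ z) zz⁻¹≈1)) (*-identityˡ x))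

  *-monoʳ-< : ∀ {z x y} → 0# < z → x < y → z * x < z * y
  *-monoʳ-< 0<z (x≤y , x≉y) = *-monoʳ-≤ (<⇒≤ 0<z) x≤y , x≉y ∘ *-cancelˡ 0<z

  -1*-1≈1 : (- 1#) * (- 1#) ≈ 1#
  -1*-1≈1 = +-cancelʳ (- 1#) (begin-equality
    (- 1#) * (- 1#) + - 1#             ≈⟨ +-congˡ (*-identityʳ (- 1#)) ⟨
    (- 1#) * (- 1#) + (- 1#) * 1#      ≈⟨ distribˡ (- 1#) (- 1#) 1# ⟨
    (- 1#) * (- 1# + 1#)               ≈⟨ *-congˡ (-‿inverseˡ 1#) ⟩
    (- 1#) * 0#                        ≈⟨ zeroʳ (- 1#) ⟩
    0#                                 ≈⟨ -‿inverseʳ 1# ⟨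
    1# + - 1#                          ∎)

  -- If 1 ≤ 0 then -1 is nonnegative, and so is its square 1.
  0<1 : 0# < 1#
  0<1 with total 0# 1#
  ... | inj₁ 0≤1 = 0≤1 , 0≉1
  ... | inj₂ 1≤0 = ≤-respʳ -1*-1≈1 (*-nonneg 0≤-1 0≤-1) , 0≉1
    where
    0≤-1 : 0# ≤ - 1#
    0≤-1 = ≤-respˡ (-‿inverseʳ 1#) (≤-respʳ (+-identityˡ (- 1#)) (+-monoˡ-≤ (- 1#) 1≤0))

  ι-+ : ∀ m n → ι (m ℕ.+ n) ≈ ι m + ι n
  ι-+ = ×-homo-+ 1#

  ι-* : ∀ m n → ι (m ℕ.* n) ≈ ι m * ι n
  ι-* = ×1-homo-*

  0≤ι : ∀ m → 0# ≤ ι m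
  0≤ι zero    = ≤-refl
  0≤ι (suc m) = ≤-trans (<⇒≤ 0<1) (x≤x+y 1# (0≤ι m))

  0<ι : ∀ {m} → 0 ℕ.< m → 0# < ι m
  0<ι {suc m} _ = begin-strict
    0#         <⟨ 0<1 ⟩
    1#         ≤⟨ x≤x+y 1# (0≤ι m) ⟩
    1# + ι m   ∎

  ι-mono-≤ : ∀ {m n} → m ℕ.≤ n → ι m ≤ ι n
  ι-mono-≤ {m} m≤n with ℕ.m≤n⇒∃[o]m+o≡n m≤n
  ... | o , refl = ≤-respʳ (≈-sym (ι-+ m o)) (x≤x+y (ι m) (0≤ι o))

  ι-mono-< : ∀ {m n} → m ℕ.< n → ι m < ι n
  ι-mono-< {m} {n} m<n = begin-strict
    ι m        ≈⟨ +-identityˡ (ι m) ⟨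
    0# + ι m   <⟨ +-monoˡ-< (ι m) 0<1 ⟩
    1# + ι m   ≤⟨ ι-mono-≤ m<n ⟩
    ι n        ∎

  ι-∸ : ∀ {m n o} → m ℕ.+ n ≡ o → ι o - ι n ≈ ι m
  ι-∸ {m} {n} refl = ≈-trans (+-congʳ (ι-+ m n)) ([x+y]-y≈x (ι m) (ι n))

  open Max totalOrder public using (x≤y⇒x⊔y≈y; x≤y⇒y⊔x≈y; x≤x⊔y; x≤y⊔x)

-- The linear functional |𝒜| + c |ℬ|.

module Weighted {a ℓ₁ ℓ₂} (𝔽 : OrderedField a ℓ₁ ℓ₂) (c : OrderedField.Carrier 𝔽)
  (0<c : OrderedField._<_ 𝔽 (OrderedField.0# 𝔽) c) where
  open OrderedFieldProperties 𝔽
  open PosetReasoning poset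
  open SemiringSolver commutativeSemiring using (solve; _:+_; _:*_; _:=_)

  weight : ℕ → ℕ → Carrier
  weight α β = ι α + c * ι β

  weight-mono : ∀ {α α′} β → α ℕ.≤ α′ → weight α β ≤ weight α′ β
  weight-mono β α≤α′ = +-monoˡ-≤ (c * ι β) (ι-mono-≤ α≤α′)

  weight-injective : ∀ {α α′} β → α ℕ.≤ α′ → weight α′ β ≤ weight α β → α ≡ α′
  weight-injective {α} {α′} β α≤α′ e with α ℕ.≟ α′
  ... | yes eq = eq
  ... | no ne = ⊥-elim (<⇒≱ (+-monoˡ-< (c * ι β) (ι-mono-< (ℕ.≤∧≢⇒< α≤α′ ne))) e)

  weight-scale : ∀ m α β → ι m * weight α β ≈ weight (m ℕ.* α) (m ℕ.* β)
  weight-scale m α β = begin-equality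
    ι m * (ι α + c * ι β)
      ≈⟨ solve 4 (λ m a c b → m :* (a :+ c :* b) := m :* a :+ c :* (m :* b)) ≈-refl (ι m) (ι α) c (ι β) ⟩
    ι m * ι α + c * (ι m * ι β)       ≈⟨ +-cong (ι-* m α) (*-congˡ (ι-* m β)) ⟨
    weight (m ℕ.* α) (m ℕ.* β)        ∎

  weight-+ : ∀ α β α′ β′ → weight α β + weight α′ β′ ≈ weight (α ℕ.+ α′) (β ℕ.+ β′)
  weight-+ α β α′ β′ = begin-equality
    (ι α + c * ι β) + (ι α′ + c * ι β′)
      ≈⟨ solve 5 (λ a b a′ b′ c → (a :+ c :* b) :+ (a′ :+ c :* b′) := (a :+ a′) :+ c :* (b :+ b′)) ≈-refl (ι α) (ι β) (ι α′) (ι β′) c ⟩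
    (ι α + ι α′) + c * (ι β + ι β′)      ≈⟨ +-cong (ι-+ α α′) (*-congˡ (ι-+ β β′)) ⟨
    weight (α ℕ.+ α′) (β ℕ.+ β′)         ∎

  -- The natural numbers u and w act as barycentric weights with the denominator u + w cleared. The
  -- functional is strictly increasing in its first coordinate, so a point strictly below the chord
  -- weighs less than the mean of the ends.
  weight-below-chord : ∀ {u w α α₀ α₁ β β₀ β₁ x} → 0 ℕ.< u ℕ.+ w →
    (u ℕ.+ w) ℕ.* α ℕ.< u ℕ.* α₀ ℕ.+ w ℕ.* α₁ → (u ℕ.+ w) ℕ.* β ≡ u ℕ.* β₀ ℕ.+ w ℕ.* β₁ →
    weight α₀ β₀ ≤ x → weight α₁ β₁ ≤ x → weight α β < x
  weight-below-chord {u} {w} {α} {α₀} {α₁} {β} {β₀} {β₁} {x} 0<u+w lt eq ≤₀ ≤₁ = lower (weight α β) x scaled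
    where
    scaled : ι (u ℕ.+ w) * weight α β < ι (u ℕ.+ w) * x
    scaled = begin-strict
      ι (u ℕ.+ w) * weight α β
        ≈⟨ weight-scale (u ℕ.+ w) α β ⟩
      weight ((u ℕ.+ w) ℕ.* α) ((u ℕ.+ w) ℕ.* β)
        <⟨ +-monoˡ-< (c * ι ((u ℕ.+ w) ℕ.* β)) (ι-mono-< lt) ⟩
      weight (u ℕ.* α₀ ℕ.+ w ℕ.* α₁) ((u ℕ.+ w) ℕ.* β)
        ≡⟨ cong (weight (u ℕ.* α₀ ℕ.+ w ℕ.* α₁)) eq ⟩
      weight (u ℕ.* α₀ ℕ.+ w ℕ.* α₁) (u ℕ.* β₀ ℕ.+ w ℕ.* β₁)
        ≈⟨ weight-+ (u ℕ.* α₀) (u ℕ.* β₀) (w ℕ.* α₁) (w ℕ.* β₁) ⟨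
      weight (u ℕ.* α₀) (u ℕ.* β₀) + weight (w ℕ.* α₁) (w ℕ.* β₁)
        ≈⟨ +-cong (weight-scale u α₀ β₀) (weight-scale w α₁ β₁) ⟨
      ι u * weight α₀ β₀ + ι w * weight α₁ β₁
        ≤⟨ +-mono-≤ (*-monoʳ-≤ (0≤ι u) ≤₀) (*-monoʳ-≤ (0≤ι w) ≤₁) ⟩
      ι u * x + ι w * x
        ≈⟨ distribʳ x (ι u) (ι w) ⟨
      (ι u + ι w) * x
        ≈⟨ *-congʳ (ι-+ u w) ⟨
      ι (u ℕ.+ w) * x ∎
    lower : ∀ x y → ι (u ℕ.+ w) * x < ι (u ℕ.+ w) * y → x < y
    lower x y lt with total x y
    ... | inj₁ x≤y = x≤y , λ e → <⇒≱ lt (≤-reflexive (*-congˡ (≈-sym e)))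
    ... | inj₂ y≤x = ⊥-elim (<⇒≱ lt (*-monoʳ-≤ (0≤ι (u ℕ.+ w)) y≤x))

  weight-shift : ∀ α β e → weight (α ℕ.+ e) β ≈ weight α β + 1# * ι e
  weight-shift α β e = begin-equality
    ι (α ℕ.+ e) + c * ι β          ≈⟨ +-congʳ (ι-+ α e) ⟩
    (ι α + ι e) + c * ι β
      ≈⟨ solve 3 (λ a e b → (a :+ e) :+ b := (a :+ b) :+ e) ≈-refl (ι α) (ι e) (c * ι β) ⟩
    weight α β + ι e               ≈⟨ +-congˡ (*-identityˡ (ι e)) ⟨
    weight α β + 1# * ι e          ∎

  weight-shiftʳ : ∀ α β e → weight α (β ℕ.+ e) ≈ weight α β + c * ι e
  weight-shiftʳ α β e = begin-equality
    ι α + c * ι (β ℕ.+ e)          ≈⟨ +-congˡ (*-congˡ (ι-+ β e)) ⟩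
    ι α + c * (ι β + ι e)
      ≈⟨ solve 4 (λ a c b e → a :+ c :* (b :+ e) := (a :+ c :* b) :+ c :* e) ≈-refl (ι α) c (ι β) (ι e) ⟩
    weight α β + c * ι e           ∎

  private
    *-monoˡ-≤ : ∀ {x y} z → 0# ≤ z → x ≤ y → x * z ≤ y * z
    *-monoˡ-≤ {x} {y} z 0≤z x≤y = ≤-respˡ (*-comm z x) (≤-respʳ (*-comm z y) (*-monoʳ-≤ 0≤z x≤y))

    *-monoˡ-< : ∀ {x y} z → 0# < z → x < y → x * z < y * z
    *-monoˡ-< {x} {y} z 0<z x<y = begin-strict
      x * z  ≈⟨ *-comm x z ⟩
      z * x  <⟨ *-monoʳ-< 0<z x<y ⟩
      z * y  ≈⟨ *-comm z y ⟩
      y * z  ∎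

    excess : ∀ {α α′ β β′} → β′ ℕ.≤ β → α ℕ.+ β ≡ α′ ℕ.+ β′ → ∃ λ e → β ≡ β′ ℕ.+ e × α′ ≡ α ℕ.+ e
    excess {α} {α′} {β} {β′} le eq with ℕ.m≤n⇒∃[o]m+o≡n le
    ... | e , refl = e , refl , ≡.sym (ℕ.+-cancelʳ-≡ β′ (α ℕ.+ e) α′
      (≡.trans (≡.trans (ℕ.+-assoc α e β′) (cong (α ℕ.+_) (ℕ.+-comm e β′))) eq))

  module _ {α α′ β β′ : ℕ} (total-≡ : α ℕ.+ β ≡ α′ ℕ.+ β′) where

    -- Along a line of constant α + β, moving e units from β to α changes the weight by (1 - c) e.
    -- Its sign decides this lemma and the three that follow.
    exchange-≤ : c ≤ 1# → β′ ℕ.≤ β → weight α β ≤ weight α′ β′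
    exchange-≤ c≤1 le with excess {α} {α′} le total-≡
    ... | e , refl , refl = begin
      weight α (β′ ℕ.+ e)      ≈⟨ weight-shiftʳ α β′ e ⟩
      weight α β′ + c * ι e    ≤⟨ +-monoʳ-≤ (weight α β′) (*-monoˡ-≤ (ι e) (0≤ι e) c≤1) ⟩
      weight α β′ + 1# * ι e   ≈⟨ weight-shift α β′ e ⟨
      weight (α ℕ.+ e) β′      ∎

    exchange-≥ : 1# ≤ c → β′ ℕ.≤ β → weight α′ β′ ≤ weight α β
    exchange-≥ 1≤c le with excess {α} {α′} le total-≡
    ... | e , refl , refl = begin
      weight (α ℕ.+ e) β′      ≈⟨ weight-shift α β′ e ⟩
      weight α β′ + 1# * ι e   ≤⟨ +-monoʳ-≤ (weight α β′) (*-monoˡ-≤ (ι e) (0≤ι e) 1≤c) ⟩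
      weight α β′ + c * ι e    ≈⟨ weight-shiftʳ α β′ e ⟨
      weight α (β′ ℕ.+ e)      ∎

    private
      positive : ∀ {e} → β′ ℕ.< β′ ℕ.+ e → 0 ℕ.< e
      positive {e} lt = ℕ.+-cancelˡ-< β′ 0 e (subst (ℕ._< β′ ℕ.+ e) (≡.sym (ℕ.+-identityʳ β′)) lt)

    exchange-< : c < 1# → β′ ℕ.< β → weight α β < weight α′ β′
    exchange-< c<1 lt with excess {α} {α′} (ℕ.<⇒≤ lt) total-≡
    ... | e , refl , refl = begin-strict
      weight α (β′ ℕ.+ e)      ≈⟨ weight-shiftʳ α β′ e ⟩
      weight α β′ + c * ι e    <⟨ +-monoʳ-< (weight α β′) (*-monoˡ-< (ι e) (0<ι (positive lt)) c<1) ⟩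
      weight α β′ + 1# * ι e   ≈⟨ weight-shift α β′ e ⟨
      weight (α ℕ.+ e) β′      ∎

    exchange-> : 1# < c → β′ ℕ.< β → weight α′ β′ < weight α β
    exchange-> 1<c lt with excess {α} {α′} (ℕ.<⇒≤ lt) total-≡
    ... | e , refl , refl = begin-strict
      weight (α ℕ.+ e) β′      ≈⟨ weight-shift α β′ e ⟩
      weight α β′ + 1# * ι e   <⟨ +-monoʳ-< (weight α β′) (*-monoˡ-< (ι e) (0<ι (positive lt)) 1<c) ⟩
      weight α β′ + c * ι e    ≈⟨ weight-shiftʳ α β′ e ⟨
      weight α (β′ ℕ.+ e)      ∎

-- Assembly for n > k + l and for n = k + l.

open Combinatorics
  using (pascal; C-mono-≤; C-complement; card-complements; Star; star⇒relabelling; relabelling⇒star; relabelling₁;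
         star-sizes; module CrossIntersectingPair)

theorem1p4 : ∀ {a ℓ₁ ℓ₂} (F : OrderedField a ℓ₁ ℓ₂) → let open OrderedField F in
    (n k l r : ℕ) → k ℕ.+ l ℕ.≤ n → 1 ℕ.≤ k → r ℕ.≤ l → 1 ℕ.≤ r →
    (c : Carrier) → 0# < c →
    (𝒜 ℬ : Family n) → ⟦ 𝒜 ⟧ ⊆ binom[ n ] k → ⟦ ℬ ⟧ ⊆ binom[ n ] l →
    CrossIntersecting 𝒜 ℬ →
    (n ∸ r) C (l ∸ r) ℕ.≤ # ℬ → # ℬ ℕ.≤ (n ∸ 1) C (l ∸ 1) →
    let
    value  = ι (# 𝒜) + c * ι (# ℬ)
    bound₁ = (ι (n C k) - ι ((n ∸ r) C k)) + c * ι ((n ∸ r) C (l ∸ r))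
    bound₂ = ι ((n ∸ 1) C (k ∸ 1)) + c * ι ((n ∸ 1) C (l ∸ 1))
    in
    value ≤ max bound₁ bound₂
    × (value ≈ max bound₁ bound₂ ⇔
    (
    ( bound₂ ≤ bound₁ × k ℕ.+ l ℕ.< n
    × EqualUpToRelabelling 𝒜 ℬ
    (λ A → binom[ n ] k A × Nonempty ([ r ] ∩ A))
    (λ B → binom[ n ] l B × [ r ] ⊆ₛ B) )
    ⊎ ( bound₁ ≤ bound₂ × k ℕ.+ l ℕ.< n
    × EqualUpToRelabelling 𝒜 ℬ
    (λ A → binom[ n ] k A × Contains1 A)
    (λ B → binom[ n ] l B × Contains1 B) )
    ⊎ ( n ≡ k ℕ.+ l × c < 1#
    × # ℬ ≡ (n ∸ r) C (l ∸ r)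
    × ⟦ 𝒜 ⟧ ≐ (λ A → binom[ n ] k A × ¬ co ℬ A) )
    ⊎ ( n ≡ k ℕ.+ l × c ≈ 1#
    × ((n ∸ r) C (l ∸ r) ℕ.≤ # ℬ × # ℬ ℕ.≤ (n ∸ 1) C (l ∸ 1))
    × ⟦ 𝒜 ⟧ ≐ (λ A → binom[ n ] k A × ¬ co ℬ A) )
    ⊎ ( n ≡ k ℕ.+ l × 1# < c
    × # ℬ ≡ (n ∸ 1) C (l ∸ 1)
    × ⟦ 𝒜 ⟧ ≐ (λ A → binom[ n ] k A × ¬ co ℬ A) ) ))
theorem1p4 𝔽 (suc n) (suc κ) (suc λ′) (suc ρ) k+l≤n 1≤k r≤l 1≤r c 0<c 𝒜 ℬ 𝒜-uniform ℬ-uniform cross β₀≤ ≤β₁ =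
  result (ℕ.m≤n⇒m<n∨m≡n k+l≤n)
  where
  open OrderedFieldProperties 𝔽
  open Weighted 𝔽 c 0<c
  open CrossIntersectingPair k+l≤n 𝒜 ℬ 𝒜-uniform ℬ-uniform cross
  N k l r α α₀ α₁ β β₀ β₁ b : ℕ
  N = suc n
  k = suc κ
  l = suc λ′
  r = suc ρ
  α = # 𝒜
  β = # ℬ
  -- Truncated subtraction is exact here, since C(N-r,k) ≤ C(N,k); `bound₁-weight` identifies it
  -- with the difference taken in the field.
  α₀ = (N C k) ∸ ((N ∸ r) C k)
  β₀ = (N ∸ r) C (l ∸ r)
  α₁ = n C κ
  β₁ = n C λ′
  b = N ∸ l
  bound₁ bound₂ M : Carrier
  bound₁ = (ι (N C k) - ι ((N ∸ r) C k)) + c * ι β₀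
  bound₂ = weight α₁ β₁
  M = max bound₁ bound₂

  l≤N : l ℕ.≤ N
  l≤N = ℕ.≤-trans (ℕ.m≤n+m l k) k+l≤n
  α₀-complement : α₀ ℕ.+ ((N ∸ r) C k) ≡ N C k
  α₀-complement = ℕ.m∸n+n≡m (C-mono-≤ k (ℕ.m∸n≤m N r))
  α₁-complement : α₁ ℕ.+ (n C k) ≡ N C k
  α₁-complement = ≡.sym (pascal n κ)
  β₀-complement : β₀ ≡ (N ∸ r) C b
  β₀-complement = C-complement l≤N r≤l
  β₁-complement : β₁ ≡ n C b
  β₁-complement = C-complement {N} {l} {1} l≤N (s≤s z≤n)

  bound₁-weight : bound₁ ≈ weight α₀ β₀
  bound₁-weight = +-congʳ (ι-∸ {α₀} {(N ∸ r) C k} α₀-complement)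
  bound₁≤M : bound₁ ≤ M
  bound₁≤M = x≤x⊔y bound₁ bound₂
  bound₂≤M : bound₂ ≤ M
  bound₂≤M = x≤y⊔x bound₁ bound₂
  weight₀≤M : weight α₀ β₀ ≤ M
  weight₀≤M = ≤-respˡ bound₁-weight bound₁≤M
  M≈bound₁ : bound₂ ≤ bound₁ → M ≈ bound₁
  M≈bound₁ = x≤y⇒y⊔x≈y
  M≈bound₂ : bound₁ ≤ bound₂ → M ≈ bound₂
  M≈bound₂ = x≤y⇒x⊔y≈y

  Complementary : Set
  Complementary = ⟦ 𝒜 ⟧ ≐ (λ A → binom[ N ] k A × ¬ co ℬ A)
  Relabelling₀ Relabelling₁ : Set
  Relabelling₀ = EqualUpToRelabelling 𝒜 ℬ (λ A → binom[ N ] k A × Nonempty ([ r ] ∩ A))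
    (λ B → binom[ N ] l B × [ r ] ⊆ₛ B)
  Relabelling₁ = EqualUpToRelabelling 𝒜 ℬ (λ A → binom[ N ] k A × Contains1 A) (λ B → binom[ N ] l B × Contains1 B)
  Extremal = (bound₂ ≤ bound₁ × k ℕ.+ l ℕ.< N × Relabelling₀)
    ⊎ (bound₁ ≤ bound₂ × k ℕ.+ l ℕ.< N × Relabelling₁)
    ⊎ (N ≡ k ℕ.+ l × c < 1# × β ≡ β₀ × Complementary)
    ⊎ (N ≡ k ℕ.+ l × c ≈ 1# × (β₀ ℕ.≤ β × β ℕ.≤ β₁) × Complementary)
    ⊎ (N ≡ k ℕ.+ l × 1# < c × β ≡ β₁ × Complementary)

  module Above (k+l<N : k ℕ.+ l ℕ.< N) where
    -- One less than the number N - l - k of deletions from b-sets to k-sets; for n > k + l at least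
    -- one deletion takes place.
    depth : ℕ
    depth = N ∸ suc (k ℕ.+ l)
    depth-≡ : b ≡ suc depth ℕ.+ k
    depth-≡ = ≡.trans (cong (_∸ l) (≡.trans (≡.sym (ℕ.m+[n∸m]≡n k+l<N)) (rearrange k l depth)))
      (ℕ.m+n∸n≡m (suc depth ℕ.+ k) l)
      where
      rearrange : ∀ k l j → suc (k ℕ.+ l) ℕ.+ j ≡ suc j ℕ.+ k ℕ.+ l
      rearrange = solve-∀

    at : ∀ {x y} → β ≡ x → x ≡ y C b → β ≡ y C (suc depth ℕ.+ k)
    at {y = y} p q = ≡.trans p (≡.trans q (cong (y C_) depth-≡))

    size-bound : ∀ r α′ → r ℕ.≤ l → α′ ℕ.+ ((N ∸ r) C k) ≡ N C k → β ≡ (N ∸ r) C (suc depth ℕ.+ k) → α ℕ.≤ α′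
    size-bound r α′ r≤l eq e = ℕ.+-cancelʳ-≤ ((N ∸ r) C k) _ _
      (ℕ.≤-trans (endpoint-bound refl depth-≡ r≤l e) (ℕ.≤-reflexive (≡.sym eq)))

    star-from-max : ∀ r α′ → r ℕ.≤ l → α′ ℕ.+ ((N ∸ r) C k) ≡ N C k → β ≡ (N ∸ r) C (suc depth ℕ.+ k) →
      weight α′ β ≤ weight α β → Star k l r 𝒜 ℬ
    star-from-max r α′ r≤l eq e le = endpoint-star refl depth-≡ r≤l e
      (≡.trans (cong (ℕ._+ ((N ∸ r) C k)) (weight-injective β (size-bound r α′ r≤l eq e) le)) eq)

    interior : β₀ ℕ.< β → β ℕ.< β₁ → weight α β < M
    interior lo hi = weight-below-chord {u} {w} {α} {α₀} {α₁} {β} {β₀} {β₁}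
      (ℕ.≤-trans 0<u (ℕ.m≤m+n u w))
      (interior-bound refl depth-≡ {r} {1} r≤l (s≤s z≤n)
        (≡.trans ew (cong (ℕ._+ w) (≡.trans β₀-complement (cong ((N ∸ r) C_) depth-≡))))
        (≡.trans (cong (n C_) (≡.sym depth-≡)) (≡.trans (≡.sym β₁-complement) eu))
        0<u 0<w α₀-complement α₁-complement)
      balance weight₀≤M bound₂≤M
      where
      w u : ℕ
      w = β ∸ β₀
      u = β₁ ∸ β
      ew : β ≡ β₀ ℕ.+ w
      ew = ≡.sym (ℕ.m+[n∸m]≡n (ℕ.<⇒≤ lo))
      eu : β₁ ≡ β ℕ.+ u
      eu = ≡.sym (ℕ.m+[n∸m]≡n (ℕ.<⇒≤ hi))
      0<w : 0 ℕ.< w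
      0<w = ℕ.m<n⇒0<n∸m lo
      0<u : 0 ℕ.< u
      0<u = ℕ.m<n⇒0<n∸m hi
      convex : ∀ u w x → (u ℕ.+ w) ℕ.* (x ℕ.+ w) ≡ u ℕ.* x ℕ.+ w ℕ.* (x ℕ.+ w ℕ.+ u)
      convex = solve-∀
      balance : (u ℕ.+ w) ℕ.* β ≡ u ℕ.* β₀ ℕ.+ w ℕ.* β₁
      balance = ≡.trans (cong ((u ℕ.+ w) ℕ.*_) ew) (≡.trans (convex u w β₀)
        (cong (λ x → u ℕ.* β₀ ℕ.+ w ℕ.* x) (≡.sym (≡.trans eu (cong (ℕ._+ u) ew)))))

    forward : weight α β ≤ M × (weight α β ≈ M → Extremal)
    forward with β ℕ.≟ β₀
    -- At a maximum, M is at most the weight of this end, which is the comparison of bounds asked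
    -- for in (i). For r = 1 both ends coincide and this branch covers them.
    ... | yes e = ≤-trans ≤₀ weight₀≤M , λ eq →
        let M≤ = ≤-trans (≤-reflexive (≈-sym eq)) ≤₀
            e₀ = at e β₀-complement
        in inj₁ (≤-trans bound₂≤M (≤-respʳ (≈-sym bound₁-weight) M≤) , k+l<N ,
             star⇒relabelling (ℕ.≤-trans r≤l l≤N) 𝒜 ℬ (star-from-max r α₀ r≤l α₀-complement e₀
               (≤-trans (≤-reflexive (+-congˡ (*-congˡ (reflexive (cong ι e))))) (≤-trans weight₀≤M (≤-reflexive (≈-sym eq))))))
        where
        ≤₀ : weight α β ≤ weight α₀ β₀
        ≤₀ = ≤-trans (weight-mono β (size-bound r α₀ r≤l α₀-complement (at e β₀-complement)))
          (≤-reflexive (+-congˡ (*-congˡ (reflexive (cong ι e)))))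
    ... | no ne with β ℕ.≟ β₁
    ...   | no ne′ = let (le , ne≈) = interior (ℕ.≤∧≢⇒< β₀≤ (ne ∘ ≡.sym)) (ℕ.≤∧≢⇒< ≤β₁ ne′)
                     in le , λ eq → ⊥-elim (ne≈ eq)
    ...   | yes e = ≤-trans ≤₁ bound₂≤M , λ eq →
        let M≤ = ≤-trans (≤-reflexive (≈-sym eq)) ≤₁
            e₁ = at e β₁-complement
        in inj₂ (inj₁ (≤-trans bound₁≤M M≤ , k+l<N ,
             from (relabelling₁ k l 𝒜 ℬ) (star⇒relabelling (s≤s z≤n) 𝒜 ℬ (star-from-max 1 α₁ (s≤s z≤n) α₁-complement e₁
               (≤-trans (≤-reflexive (+-congˡ (*-congˡ (reflexive (cong ι e))))) (≤-trans bound₂≤M (≤-reflexive (≈-sym eq))))))))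
        where
        ≤₁ : weight α β ≤ weight α₁ β₁
        ≤₁ = ≤-trans (weight-mono β (size-bound 1 α₁ (s≤s z≤n) α₁-complement (at e β₁-complement)))
          (≤-reflexive (+-congˡ (*-congˡ (reflexive (cong ι e)))))

    star-weight : ∀ r′ α′ → r′ ℕ.≤ l → α′ ℕ.+ ((N ∸ r′) C k) ≡ N C k → Star k l r′ 𝒜 ℬ →
      weight α β ≡ weight α′ ((N ∸ r′) C (l ∸ r′))
    star-weight r′ α′ r′≤l eq s = let (sα , sβ) = star-sizes r′≤l l≤N 𝒜 ℬ s in
      ≡.cong₂ weight (ℕ.+-cancelʳ-≡ ((N ∸ r′) C k) _ _ (≡.trans sα (≡.sym eq))) sβ

    backward : Extremal → weight α β ≈ M
    backward (inj₁ (le , _ , s)) = ≈-trans (reflexive (star-weight r α₀ r≤l α₀-complement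
      (relabelling⇒star (ℕ.≤-trans r≤l l≤N) 𝒜 ℬ s)))
      (≈-trans (≈-sym bound₁-weight) (≈-sym (M≈bound₁ le)))
    backward (inj₂ (inj₁ (le , _ , s))) = ≈-trans (reflexive (star-weight 1 α₁ (s≤s z≤n) α₁-complement
      (relabelling⇒star (s≤s z≤n) 𝒜 ℬ (to (relabelling₁ k l 𝒜 ℬ) s))))
      (≈-sym (M≈bound₂ le))
    backward (inj₂ (inj₂ (inj₁ (e , _)))) = ⊥-elim (ℕ.<-irrefl (≡.sym e) k+l<N)
    backward (inj₂ (inj₂ (inj₂ (inj₁ (e , _))))) = ⊥-elim (ℕ.<-irrefl (≡.sym e) k+l<N)
    backward (inj₂ (inj₂ (inj₂ (inj₂ (e , _))))) = ⊥-elim (ℕ.<-irrefl (≡.sym e) k+l<N)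

  module Equal (k+l≡N : k ℕ.+ l ≡ N) where
    b≡k : b ≡ k
    b≡k = ≡.trans (cong (_∸ l) (≡.sym k+l≡N)) (ℕ.m+n∸n≡m k l)

    complementary : Complementary ⇔ (α ℕ.+ β ≡ N C k)
    complementary = complementary⇔ b≡k

    total₀ : α₀ ℕ.+ β₀ ≡ N C k
    total₀ = ≡.trans (cong (α₀ ℕ.+_) (≡.trans β₀-complement (cong ((N ∸ r) C_) b≡k))) α₀-complement
    total₁ : α₁ ℕ.+ β₁ ≡ N C k
    total₁ = ≡.trans (cong (α₁ ℕ.+_) (≡.trans β₁-complement (cong (n C_) b≡k))) α₁-complement

    total-≤ : α ℕ.+ β ℕ.≤ N C k
    total-≤ = subst (λ m → α ℕ.+ m ℕ.≤ N C k) (card-complements ℬ) (card-bound 0 b≡k)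

    -- The ceiling for |𝒜| at the given |ℬ|. The loss splits into the gap from α to α*, closed
    -- exactly by complementary pairs, and a move along the line α + β = C(N,k), which contains both
    -- end configurations.
    α* : ℕ
    α* = (N C k) ∸ β
    total* : α* ℕ.+ β ≡ N C k
    total* = ℕ.m∸n+n≡m (ℕ.≤-trans (ℕ.m≤n+m β α) total-≤)
    α≤α* : α ℕ.≤ α*
    α≤α* = ℕ.+-cancelʳ-≤ β _ _ (ℕ.≤-trans total-≤ (ℕ.≤-reflexive (≡.sym total*)))
    same : ∀ {x y} → x ≡ N C k → y ≡ N C k → x ≡ y
    same p q = ≡.trans p (≡.sym q)

    ≤-weight* : weight α β ≤ weight α* β
    ≤-weight* = weight-mono β α≤α*

    saturated : weight α* β ≤ weight α β → Complementary
    saturated le = from complementary (≡.trans (cong (ℕ._+ β) (weight-injective β α≤α* le)) total*)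

    complementary⇒α* : Complementary → weight α β ≡ weight α* β
    complementary⇒α* C = cong (λ x → weight x β) (ℕ.+-cancelʳ-≡ β _ _ (same (to complementary C) total*))

    Conclusion : Set _
    Conclusion = weight α β ≤ M × (weight α β ≈ M ⇔ Extremal)

    impossible : ∀ {p} {P : Set p} → k ℕ.+ l ℕ.< N → P
    impossible lt = ⊥-elim (ℕ.<-irrefl k+l≡N lt)

    -- Every unit moved from β to α gains 1 - c > 0, so the least admissible |ℬ| is the sole
    -- maximiser and the first bound is the larger one.
    below : c < 1# → Conclusion
    below c<1 = ≤-trans ≤-weight* *≤M , mk⇔ forward backward
      where
      c≤1 = <⇒≤ c<1
      *≤₀ : weight α* β ≤ weight α₀ β₀
      *≤₀ = exchange-≤ (same total* total₀) c≤1 β₀≤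
      *≤M : weight α* β ≤ M
      *≤M = ≤-trans *≤₀ weight₀≤M
      M≈₀ : M ≈ weight α₀ β₀
      M≈₀ = ≈-trans (M≈bound₁ (≤-respʳ (≈-sym bound₁-weight)
        (exchange-≤ (same total₁ total₀) c≤1 (ℕ.≤-trans β₀≤ ≤β₁)))) bound₁-weight
      forward : weight α β ≈ M → Extremal
      forward eq = inj₂ (inj₂ (inj₁ (≡.sym k+l≡N , c<1 , β≡β₀ ,
        saturated (≤-trans *≤M (≤-reflexive (≈-sym eq))))))
        where
        β≡β₀ : β ≡ β₀
        β≡β₀ with β ℕ.≟ β₀
        ... | yes e = e
        ... | no ne = ⊥-elim (<⇒≱ (exchange-< (same total* total₀) c<1 (ℕ.≤∧≢⇒< β₀≤ (ne ∘ ≡.sym)))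
          (≤-trans weight₀≤M (≤-trans (≤-reflexive (≈-sym eq)) ≤-weight*)))
      backward : Extremal → weight α β ≈ M
      backward (inj₁ (_ , lt , _)) = impossible lt
      backward (inj₂ (inj₁ (_ , lt , _))) = impossible lt
      backward (inj₂ (inj₂ (inj₁ (_ , _ , e , C)))) = ≈-trans (reflexive (≡.cong₂ weight
        (ℕ.+-cancelʳ-≡ β₀ _ _ (same (≡.trans (cong (α ℕ.+_) (≡.sym e)) (to complementary C)) total₀)) e)) (≈-sym M≈₀)
      backward (inj₂ (inj₂ (inj₂ (inj₁ (_ , e , _))))) = ⊥-elim (proj₂ c<1 e)
      backward (inj₂ (inj₂ (inj₂ (inj₂ (_ , lt , _))))) = ⊥-elim (<⇒≱ lt c≤1)

    -- The exchange now favours β, so the greatest admissible |ℬ| takes over.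
    above : 1# < c → Conclusion
    above 1<c = ≤-trans ≤-weight* *≤M , mk⇔ forward backward
      where
      1≤c = <⇒≤ 1<c
      *≤₁ : weight α* β ≤ weight α₁ β₁
      *≤₁ = exchange-≥ (same total₁ total*) 1≤c ≤β₁
      *≤M : weight α* β ≤ M
      *≤M = ≤-trans *≤₁ bound₂≤M
      M≈₁ : M ≈ weight α₁ β₁
      M≈₁ = M≈bound₂ (≤-respˡ (≈-sym bound₁-weight) (exchange-≥ (same total₁ total₀) 1≤c (ℕ.≤-trans β₀≤ ≤β₁)))
      forward : weight α β ≈ M → Extremal
      forward eq = inj₂ (inj₂ (inj₂ (inj₂ (≡.sym k+l≡N , 1<c , β≡β₁ ,
        saturated (≤-trans *≤M (≤-reflexive (≈-sym eq)))))))
        where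
        β≡β₁ : β ≡ β₁
        β≡β₁ with β ℕ.≟ β₁
        ... | yes e = e
        ... | no ne = ⊥-elim (<⇒≱ (exchange-> (same total₁ total*) 1<c (ℕ.≤∧≢⇒< ≤β₁ ne))
          (≤-trans bound₂≤M (≤-trans (≤-reflexive (≈-sym eq)) ≤-weight*)))
      backward : Extremal → weight α β ≈ M
      backward (inj₁ (_ , lt , _)) = impossible lt
      backward (inj₂ (inj₁ (_ , lt , _))) = impossible lt
      backward (inj₂ (inj₂ (inj₁ (_ , lt , _)))) = ⊥-elim (<⇒≱ lt 1≤c)
      backward (inj₂ (inj₂ (inj₂ (inj₁ (_ , e , _))))) = ⊥-elim (proj₂ 1<c (≈-sym e))
      backward (inj₂ (inj₂ (inj₂ (inj₂ (_ , _ , e , C))))) = ≈-trans (reflexive (≡.cong₂ weight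
        (ℕ.+-cancelʳ-≡ β₁ _ _ (same (≡.trans (cong (α ℕ.+_) (≡.sym e)) (to complementary C)) total₁)) e)) (≈-sym M≈₁)

    -- The weight is constant along the line, so attaining the bound means closing the gap to α*,
    -- whatever the size of ℬ.
    balanced : c ≈ 1# → Conclusion
    balanced c≈1 = ≤-trans ≤-weight* (≤-reflexive *≈M) , mk⇔ forward backward
      where
      c≤1 = ≤-reflexive c≈1
      1≤c = ≤-reflexive (≈-sym c≈1)
      *≈₀ : weight α* β ≈ weight α₀ β₀
      *≈₀ = antisym (exchange-≤ (same total* total₀) c≤1 β₀≤) (exchange-≥ (same total* total₀) 1≤c β₀≤)
      M≈₀ : M ≈ weight α₀ β₀
      M≈₀ = ≈-trans (M≈bound₁ (≤-respʳ (≈-sym bound₁-weight)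
        (exchange-≤ (same total₁ total₀) c≤1 (ℕ.≤-trans β₀≤ ≤β₁)))) bound₁-weight
      *≈M : weight α* β ≈ M
      *≈M = ≈-trans *≈₀ (≈-sym M≈₀)
      forward : weight α β ≈ M → Extremal
      forward eq = inj₂ (inj₂ (inj₂ (inj₁ (≡.sym k+l≡N , c≈1 , (β₀≤ , ≤β₁) ,
        saturated (≤-reflexive (≈-trans *≈M (≈-sym eq)))))))
      backward : Extremal → weight α β ≈ M
      backward (inj₁ (_ , lt , _)) = impossible lt
      backward (inj₂ (inj₁ (_ , lt , _))) = impossible lt
      backward (inj₂ (inj₂ (inj₁ (_ , lt , _)))) = ⊥-elim (<⇒≱ lt 1≤c)
      backward (inj₂ (inj₂ (inj₂ (inj₁ (_ , _ , _ , C))))) = ≈-trans (reflexive (complementary⇒α* C)) *≈M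
      backward (inj₂ (inj₂ (inj₂ (inj₂ (_ , lt , _))))) = ⊥-elim (<⇒≱ lt c≤1)

    conclusion : Conclusion
    conclusion with c ≟ 1#
    ... | yes c≈1 = balanced c≈1
    ... | no c≉1 with total c 1#
    ...   | inj₁ c≤1 = below (c≤1 , c≉1)
    ...   | inj₂ 1≤c = above (1≤c , c≉1 ∘ ≈-sym)

  result : k ℕ.+ l ℕ.< N ⊎ k ℕ.+ l ≡ N → weight α β ≤ M × (weight α β ≈ M ⇔ Extremal)
  result (inj₁ lt) = proj₁ (Above.forward lt) , mk⇔ (proj₂ (Above.forward lt)) (Above.backward lt)
  result (inj₂ eq) = Equal.conclusion eq
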